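{- Let $n\ge 7$ be an integer. Every connected graph $G$ of order $n$ and size at most $\lfloor 3n/2\rfloor$ has an independent minimum vertex cut. Moreover, the bound is best possible: for every integer $n\ge 7$ there exists a connected graph of order $n$ and size $\lfloor 3n/2\rfloor+1$ which has no independent minimum vertex cut.
   Context: All graphs are finite and simple. The order of a graph is its number of vertices and the size is its number of edges. A vertex cut of a connected graph $G$ is a set $S\subset V(G)$ such that $G-S$ is disconnected. If $G$ has connectivity $k$, a vertex cut $S$ is called minimum if $|S|=k$. A vertex cut $S$ is called an independent vertex cut if $S$ is an independent set of $G$. -}

module Defs where

open import Data.Fin using (Fin)
open import Data.Fin.Properties using (_<?_)
open import Data.Fin.Subset using (Subset; _∈_; _∉_; ∁; ∣_∣)
open import Data.List using (List; length; filter; cartesianProduct; allFin)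
open import Data.Nat using (ℕ; _≤_)
open import Data.Product using (_×_; _,_; ∃-syntax)
open import Data.Sum using (_⊎_)
open import Level using (0ℓ)
open import Relation.Binary.Construct.Closure.ReflexiveTransitive using (Star)
open import Relation.Binary.Core using (Rel)
open import Relation.Binary.Definitions using (Symmetric; Irreflexive; Decidable)
open import Relation.Binary.PropositionalEquality using (_≡_)
open import Relation.Nullary using (¬_)
open import Relation.Nullary.Decidable using (_×-dec_)

record Graph (n : ℕ) : Set₁ where
  infix 4 _~_ _~?_
  field
    _~_    : Rel (Fin n) 0ℓ
    _~?_   : Decidable _~_
    ~-sym  : Symmetric _~_
    ~-irr  : Irreflexive _≡_ _~_

module _ {n : ℕ} (G : Graph n) where
  open Graph G

  -- Each edge {i , j} is listed once, as the pair with i < j.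
  edges : List (Fin n × Fin n)
  edges = filter (λ (i , j) → (i <? j) ×-dec (i ~? j))
                 (cartesianProduct (allFin n) (allFin n))

  size : ℕ
  size = length edges

  Connected : Set
  Connected = ∀ u v → Star _~_ u v

  -- Adjacency in G - S; the vertices of G - S are those v with v ∉ S.
  AdjOutside : Subset n → Rel (Fin n) 0ℓ
  AdjOutside S u v = u ∉ S × v ∉ S × u ~ v

  IsVertexCut : Subset n → Set
  IsVertexCut S = ∃[ u ] ∃[ v ] u ∉ S × v ∉ S × ¬ Star (AdjOutside S) u v

  -- G - S is disconnected or a single vertex; the second alternative gives
  -- the complete graph on n vertices its usual connectivity n - 1.
  Separates : Subset n → Set
  Separates S = IsVertexCut S ⊎ ∣ ∁ S ∣ ≡ 1

  HasConnectivity : ℕ → Set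
  HasConnectivity k =
    (∃[ S ] Separates S × ∣ S ∣ ≡ k) × (∀ S → Separates S → k ≤ ∣ S ∣)

  IsMinimumVertexCut : Subset n → Set
  IsMinimumVertexCut S = IsVertexCut S × HasConnectivity ∣ S ∣

  IsIndependent : Subset n → Set
  IsIndependent S = ∀ {u v} → u ∈ S → v ∈ S → ¬ u ~ v

  HasIndependentMinimumVertexCut : Set
  HasIndependentMinimumVertexCut = ∃[ S ] IsMinimumVertexCut S × IsIndependent S

{-# OPTIONS --safe #-}
-- Part 1.  Call G robust if deleting two non-adjacent (possibly equal) vertices never disconnects
-- it.  If G is not robust, it has an independent minimum cut of size one or two.  In a robust graph
-- on at least four vertices, a vertex of degree two has adjacent neighbours, so it can be deleted
-- without losing robustness; induction yields 2m ≥ 3n for n ≥ 6, strictly if n ≥ 7 and there is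
-- such a vertex.  Hence a robust G with n ≥ 7 and m ≤ 3n/2 is cubic, and then it is 3-connected.
-- If no neighbourhood N(v) is independent, take a triangle abc with third neighbours a′, b′, c′:
-- if, say, b′ and c′ are not adjacent, then {a , b′ , c′} is an independent cut; otherwise G is
-- the prism, of order six.
--
-- Part 2.  Truncating vertices of K₄ gives 3-connected cubic graphs of every even order.  Joining
-- one or two new vertices to both ends of an edge keeps the graph robust, yet makes its
-- connectivity 2, so no minimum cut is independent.
module Submission where

open import Defs
open import Algebra.Properties.CommutativeMonoid.Sum using ()
open import Data.Bool using (true; false; if_then_else_)
open import Data.Empty using (⊥; ⊥-elim)
open import Data.Fin using (Fin; zero; suc; _<_; punchIn; punchOut)
open import Data.Fin.Properties using (_≟_; _<?_; any?; injective⇒≤; <-cmp; punchInᵢ≢i; punchIn-injective; punchIn-punchOut)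
open import Data.Fin.Subset using (Subset; ∣_∣; ⁅_⁆; _∪_; inside; outside) renaming (_∈_ to _∈ˢ_; _⊃_ to _⊃ˢ_)
open import Data.Fin.Subset.Induction using (⊃-wellFounded)
open import Data.Fin.Subset.Properties using (x∈⁅x⁆; x∈⁅y⁆⇒x≡y; x∈p∪q⁺; x∈p∪q⁻; ∣∁p∣≡n∸∣p∣) renaming (_∈?_ to _∈ˢ?_)
open import Data.List using (List; []; _∷_; _++_; length; lookup; filter; map; tabulate; allFin; cartesianProduct)
open import Data.List.Membership.Propositional using (_∈_; _∉_)
open import Data.List.Membership.Propositional.Properties using (∈-allFin; ∈-filter⁺; ∈-filter⁻; ∈-lookup; ∈-map⁺; ∈-map⁻)
open import Data.List.Properties using (filter-++; length-++; map-tabulate; length-tabulate)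
open import Data.List.Relation.Binary.Subset.Propositional using (_⊆_)
open import Data.List.Relation.Unary.All as All using ([]; _∷_)
open import Data.List.Relation.Unary.AllPairs using ([]; _∷_)
open import Data.List.Relation.Unary.Any using (here; there; index)
open import Data.List.Relation.Unary.Any.Properties using (lookup-index)
open import Data.List.Relation.Unary.Unique.Propositional using (Unique)
open import Data.List.Relation.Unary.Unique.Propositional.Properties using (allFin⁺; filter⁺)
open import Data.Nat as ℕ using (ℕ; zero; suc; _+_; _*_; _∸_; _≤_; z≤n; s≤s)
open import Data.Nat.DivMod using (_/_; m/n*n≤m; m*n/n≡m; +-distrib-/-∣ʳ)
open import Data.Nat.Divisibility using (divides)
open import Data.Nat.Tactic.RingSolver using (solve-∀)
open import Data.Nat.Properties as ℕ using (+-0-commutativeMonoid; +-identityʳ)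
open import Data.Product using (_×_; _,_; proj₁; proj₂; ∃-syntax)
open import Data.Sum using (_⊎_; inj₁; inj₂)
open import Data.Vec using ([]; _∷_)
open import Data.Vec.Properties using (lookup⇒[]=; []=⇒lookup; lookup∘tabulate)
import Data.Vec as Vec
open import Data.Unit using (⊤; tt)
open import Function using (_∘_; id)
open import Induction.WellFounded using (Acc; acc)
open import Level using (0ℓ)
open import Relation.Binary.Construct.Closure.ReflexiveTransitive using (Star; ε; _◅_; _◅◅_; return; kleisliStar; reverse)
import Relation.Binary.Construct.Closure.ReflexiveTransitive as Star
open import Relation.Binary.Core using (Rel)
open import Relation.Binary.Definitions using (Decidable; tri<; tri≈; tri>)
open import Relation.Binary.PropositionalEquality using (_≡_; _≢_; refl; sym; trans; cong; cong₂; subst; module ≡-Reasoning)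
open import Relation.Nullary using (¬_; Dec; yes; no; does; contradiction)
open import Relation.Nullary.Decidable using (_×-dec_; _⊎-dec_; _→-dec_; ¬?; decidable-stable; dec-true; dec-false)
import Relation.Unary as U

open Algebra.Properties.CommutativeMonoid.Sum +-0-commutativeMonoid
  using (sum; sum-syntax; sum-cong-≗; sum-remove; ∑-distrib-+; ∑-comm)

-- Counting

lookup-injective : ∀ {A : Set} {xs : List A} → Unique xs → ∀ {i j} →
  lookup xs i ≡ lookup xs j → i ≡ j
lookup-injective (_ ∷ _) {zero}  {zero}  _ = refl
lookup-injective {xs = _ ∷ xs} (x≢ ∷ _) {zero} {suc j} eq =
  contradiction eq (All.lookup x≢ (∈-lookup {xs = xs} j))
lookup-injective {xs = _ ∷ xs} (x≢ ∷ _) {suc i} {zero} eq =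
  contradiction (sym eq) (All.lookup x≢ (∈-lookup {xs = xs} i))
lookup-injective (_ ∷ u) {suc i} {suc j} eq = cong suc (lookup-injective u eq)

-- Pigeonhole: each position of `xs` is sent to a position of the same element in `ys`, and
-- uniqueness of `xs` makes this map injective. Repetitions in `ys` do no harm.
⊆-length : ∀ {A : Set} {xs ys : List A} → Unique xs → xs ⊆ ys → length xs ≤ length ys
⊆-length {xs = xs} {ys} u xs⊆ys = injective⇒≤ {f = λ i → index (at i)} inj
  where
  at : ∀ i → lookup xs i ∈ ys
  at i = xs⊆ys (∈-lookup {xs = xs} i)
  inj : ∀ {i j} → index (at i) ≡ index (at j) → i ≡ j
  inj {i} {j} eq = lookup-injective u
    (trans (lookup-index (at i)) (trans (cong (lookup ys) eq) (sym (lookup-index (at j)))))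

module _ {n : ℕ} where
  open import Data.List.Membership.DecPropositional (_≟_ {n}) using (_∈?_) public

-- If `L` held every vertex, the `n` distinct entries of `allFin n` would fit into a list shorter
-- than `n`. Lower bounds on the order often enter through this lemma, as a vertex on the far side
-- of a cut.
fresh : ∀ {n} (L : List (Fin n)) → length L ℕ.< n → ∃[ w ] w ∉ L
fresh {n} L |L|<n with any? (λ w → ¬? (w ∈? L))
... | yes w∉ = w∉
... | no all∈ = contradiction
        (subst (_≤ length L) (length-tabulate id)
          (⊆-length (allFin⁺ n) λ {w} _ → decidable-stable (w ∈? L) λ w∉ → all∈ (w , w∉)))
        (ℕ.<⇒≱ |L|<n)

ind : ∀ {P : Set} → Dec P → ℕ
ind d = if does d then 1 else 0

ind-true : ∀ {P : Set} (d : Dec P) → P → ind d ≡ 1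
ind-true d p = cong (if_then 1 else 0) (dec-true d p)

ind-false : ∀ {P : Set} (d : Dec P) → ¬ P → ind d ≡ 0
ind-false d ¬p = cong (if_then 1 else 0) (dec-false d ¬p)

ind-cong : ∀ {P Q : Set} (d : Dec P) (e : Dec Q) → (P → Q) → (Q → P) → ind d ≡ ind e
ind-cong (yes p) e f g = sym (ind-true e (f p))
ind-cong (no ¬p) e f g = sym (ind-false e (¬p ∘ g))

length-filter-tabulate : ∀ {A : Set} {P : A → Set} (P? : U.Decidable P) {n} (f : Fin n → A) →
  length (filter P? (tabulate f)) ≡ ∑[ i < n ] ind (P? (f i))
length-filter-tabulate P? {zero} f = refl
length-filter-tabulate P? {suc n} f with does (P? (f zero))
... | true  = cong suc (length-filter-tabulate P? (f ∘ suc))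
... | false = length-filter-tabulate P? (f ∘ suc)

length-filter-cartesianProduct : ∀ {A B : Set} {P : A × B → Set} (P? : U.Decidable P)
  {m n} (f : Fin m → A) (g : Fin n → B) →
  length (filter P? (cartesianProduct (tabulate f) (tabulate g)))
    ≡ ∑[ i < m ] ∑[ j < n ] ind (P? (f i , g j))
length-filter-cartesianProduct P? {zero} f g = refl
length-filter-cartesianProduct P? {suc m} f g = begin
  length (filter P? (row ++ rest))
    ≡⟨ cong length (filter-++ P? row rest) ⟩
  length (filter P? row ++ filter P? rest)
    ≡⟨ length-++ (filter P? row) ⟩
  length (filter P? row) + length (filter P? rest)
    ≡⟨ cong₂ _+_
         (trans (cong (length ∘ filter P?) (map-tabulate g (f zero ,_)))
                (length-filter-tabulate P? (λ j → f zero , g j)))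
         (length-filter-cartesianProduct P? (f ∘ suc) g) ⟩
  _ ∎
  where
  open ≡-Reasoning
  row = map (f zero ,_) (tabulate g)
  rest = cartesianProduct (tabulate (f ∘ suc)) (tabulate g)

sum-lowerBound : ∀ {n} (f : Fin n → ℕ) c → (∀ i → c ≤ f i) → n * c ≤ sum f
sum-lowerBound {zero}  f c c≤ = z≤n
sum-lowerBound {suc n} f c c≤ = ℕ.+-mono-≤ (c≤ zero) (sum-lowerBound (f ∘ suc) c (c≤ ∘ suc))

sum-const : ∀ n c → (∑[ i < n ] c) ≡ n * c
sum-const zero c = refl
sum-const (suc n) c = cong (c +_) (sum-const n c)

-- Set the term at `i` apart: the remaining terms already use up `n * c`, which leaves at most `c`
-- for `f i`.
sum-tight : ∀ {n} (f : Fin n → ℕ) c → (∀ i → c ≤ f i) → sum f ≤ n * c → ∀ i → f i ≡ c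
sum-tight {suc n} f c c≤ sum≤ i = ℕ.≤-antisym (ℕ.+-cancelʳ-≤ (n * c) (f i) c (begin
    f i + n * c                 ≤⟨ ℕ.+-monoʳ-≤ (f i) (sum-lowerBound (f ∘ punchIn i) c (c≤ ∘ punchIn i)) ⟩
    f i + sum (f ∘ punchIn i)           ≡⟨ sum-remove {i = i} f ⟨
    sum f                       ≤⟨ sum≤ ⟩
    c + n * c                   ∎)) (c≤ i)
  where open ℕ.≤-Reasoning

-- Subsets as lists

elements : ∀ {n} → Subset n → List (Fin n)
elements {n} S = filter (_∈ˢ? S) (allFin n)

∑-ind-∈ : ∀ {n} (S : Subset n) → (∑[ i < n ] ind (i ∈ˢ? S)) ≡ ∣ S ∣
∑-ind-∈ [] = refl
∑-ind-∈ (inside  ∷ S) = cong suc (∑-ind-∈ S)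
∑-ind-∈ (outside ∷ S) = ∑-ind-∈ S

length-elements : ∀ {n} (S : Subset n) → length (elements S) ≡ ∣ S ∣
length-elements S = trans (length-filter-tabulate (_∈ˢ? S) id) (∑-ind-∈ S)

∈-elements⁺ : ∀ {n} {S : Subset n} {i} → i ∈ˢ S → i ∈ elements S
∈-elements⁺ {S = S} {i} = ∈-filter⁺ (_∈ˢ? S) (∈-allFin i)

∈-elements⁻ : ∀ {n} {S : Subset n} {i} → i ∈ elements S → i ∈ˢ S
∈-elements⁻ {S = S} = proj₂ ∘ ∈-filter⁻ (_∈ˢ? S) {xs = allFin _}

fromList : ∀ {n} → List (Fin n) → Subset n
fromList L = Vec.tabulate (λ i → does (i ∈? L))

∈-fromList⁺ : ∀ {n} {L : List (Fin n)} {i} → i ∈ L → i ∈ˢ fromList L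
∈-fromList⁺ {L = L} {i} i∈L =
  lookup⇒[]= i _ (trans (lookup∘tabulate _ i) (dec-true (i ∈? L) i∈L))

∈-fromList⁻ : ∀ {n} {L : List (Fin n)} {i} → i ∈ˢ fromList L → i ∈ L
∈-fromList⁻ {L = L} {i} i∈S = decidable-stable (i ∈? L) λ i∉L →
  contradiction (trans (sym (dec-false (i ∈? L) i∉L))
                  (trans (sym (lookup∘tabulate _ i)) ([]=⇒lookup i∈S))) λ ()

-- Only an inequality, because `L` may repeat a vertex. Bounding the size of a cut from above is
-- what the minimality arguments need.
∣fromList∣≤length : ∀ {n} (L : List (Fin n)) → ∣ fromList L ∣ ≤ length L
∣fromList∣≤length L = subst (_≤ length L) (length-elements (fromList L))
  (⊆-length (filter⁺ (_∈ˢ? fromList L) (allFin⁺ _)) (∈-fromList⁻ {L = L} ∘ ∈-elements⁻))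

-- Reachability

-- The invariant principle behind the cut arguments: a property that holds at `u`, survives every
-- step and fails at `v` rules out a path from `u` to `v`.
Star-closed : ∀ {A : Set} {R : Rel A 0ℓ} (P : A → Set) → (∀ {a b} → R a b → P a → P b) →
  ∀ {u v} → Star R u v → P u → P v
Star-closed P closed ε        Pu = Pu
Star-closed P closed (r ◅ rs) Pu = Star-closed P closed rs (closed r Pu)

module _ {n : ℕ} {R : Rel (Fin n) 0ℓ} (R? : Decidable R) where

  -- As long as some step leaves `C`, its end is added; this stops because a finite set cannot grow
  -- strictly forever. Closure of the result refutes paths to vertices outside it, so reachability,
  -- and with it the search for cuts, is decidable.
  reachableSet : ∀ u → ∃[ C ] (u ∈ˢ C × (∀ {i} → i ∈ˢ C → Star R u i) ×
                               (∀ {i j} → R i j → i ∈ˢ C → j ∈ˢ C))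
  reachableSet u = saturate ⁅ u ⁆ (⊃-wellFounded _) (x∈⁅x⁆ u)
      (λ i∈ → subst (Star R u) (sym (x∈⁅y⁆⇒x≡y u i∈)) ε)
    where
    saturate : ∀ C → Acc _⊃ˢ_ C → u ∈ˢ C → (∀ {i} → i ∈ˢ C → Star R u i) →
      ∃[ C ] (u ∈ˢ C × (∀ {i} → i ∈ˢ C → Star R u i) ×
              (∀ {i j} → R i j → i ∈ˢ C → j ∈ˢ C))
    saturate C (acc rec) u∈C reach
      with any? (λ i → any? (λ j → (i ∈ˢ? C) ×-dec R? i j ×-dec ¬? (j ∈ˢ? C)))
    ... | no closed = C , u∈C , reach , λ {i} {j} r i∈C →
            decidable-stable (j ∈ˢ? C) λ j∉C → closed (i , j , i∈C , r , j∉C)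
    ... | yes (i , j , i∈C , r , j∉C) =
            saturate (⁅ j ⁆ ∪ C) (rec (grow , j , x∈p∪q⁺ (inj₁ (x∈⁅x⁆ j)) , j∉C))
              (grow u∈C) reach′
      where
      grow : ∀ {k} → k ∈ˢ C → k ∈ˢ ⁅ j ⁆ ∪ C
      grow k∈C = x∈p∪q⁺ (inj₂ k∈C)
      reach′ : ∀ {k} → k ∈ˢ ⁅ j ⁆ ∪ C → Star R u k
      reach′ k∈ with x∈p∪q⁻ ⁅ j ⁆ C k∈
      ... | inj₁ k∈j = subst (Star R u) (sym (x∈⁅y⁆⇒x≡y j k∈j)) (reach i∈C ◅◅ return r)
      ... | inj₂ k∈C = reach k∈C

  star? : Decidable (Star R)
  star? u v with reachableSet u
  ... | C , u∈C , reach , closed with v ∈ˢ? C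
  ...   | yes v∈C = yes (reach v∈C)
  ...   | no  v∉C = no λ path → v∉C (Star-closed (_∈ˢ C) closed path u∈C)

-- Vertex cuts given as lists of vertices

module _ {n : ℕ} (G : Graph n) where
  open Graph G

  AdjOff : List (Fin n) → Rel (Fin n) 0ℓ
  AdjOff L u v = u ∉ L × v ∉ L × u ~ v

  ConnectedOff : List (Fin n) → Set
  ConnectedOff L = ∀ u v → u ∉ L → v ∉ L → Star (AdjOff L) u v

  DisconnectedOff : List (Fin n) → Set
  DisconnectedOff L = ∃[ u ] ∃[ v ] (u ∉ L × v ∉ L × ¬ Star (AdjOff L) u v)

  -- The case x ≡ y says that G has no cut vertex.
  Robust : Set
  Robust = ∀ x y → ¬ x ~ y → ConnectedOff (x ∷ y ∷ [])

  ThreeConnected : Set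
  ThreeConnected = ∀ x y → ConnectedOff (x ∷ y ∷ [])

  AdjOff-sym : ∀ {L u v} → AdjOff L u v → AdjOff L v u
  AdjOff-sym (u∉ , v∉ , u~v) = v∉ , u∉ , ~-sym u~v

  adjOff? : ∀ L → Decidable (AdjOff L)
  adjOff? L u v = ¬? (u ∈? L) ×-dec ¬? (v ∈? L) ×-dec (u ~? v)

  disconnectedOff? : ∀ L → Dec (DisconnectedOff L)
  disconnectedOff? L = any? λ u → any? λ v →
    ¬? (u ∈? L) ×-dec ¬? (v ∈? L) ×-dec ¬? (star? (adjOff? L) u v)

  ¬disconnectedOff⇒connectedOff : ∀ {L} → ¬ DisconnectedOff L → ConnectedOff L
  ¬disconnectedOff⇒connectedOff {L} ¬disc u v u∉ v∉ =
    decidable-stable (star? (adjOff? L) u v) λ ¬path → ¬disc (u , v , u∉ , v∉ , ¬path)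

  connectedOff-resp : ∀ {L M} → L ⊆ M → M ⊆ L → ConnectedOff L → ConnectedOff M
  connectedOff-resp L⊆M M⊆L conn u v u∉ v∉ =
    Star.map (λ (a∉ , b∉ , a~b) → a∉ ∘ M⊆L , b∉ ∘ M⊆L , a~b)
      (conn u v (u∉ ∘ L⊆M) (v∉ ∘ L⊆M))

  -- A nonempty path out of `v` would begin with a step into `L`.
  trapped : ∀ {L v w} → ConnectedOff L → v ∉ L → w ∉ L → (∀ {j} → v ~ j → j ∈ L) → v ≡ w
  trapped conn v∉ w∉ nbrs⊆ with conn _ _ v∉ w∉
  ... | ε = refl
  ... | (_ , j∉ , v~j) ◅ _ = contradiction (nbrs⊆ v~j) j∉

  isVertexCut-fromList : ∀ {L} → DisconnectedOff L → IsVertexCut G (fromList L)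
  isVertexCut-fromList {L} (u , v , u∉ , v∉ , ¬path) =
    u , v , u∉ ∘ ∈-fromList⁻ , v∉ ∘ ∈-fromList⁻ , λ path →
      ¬path (Star.map (λ (a∉ , b∉ , a~b) →
        a∉ ∘ ∈-fromList⁺ , b∉ ∘ ∈-fromList⁺ , a~b) path)

  connectedOff⇒¬isVertexCut : ∀ {S} → ConnectedOff (elements S) → ¬ IsVertexCut G S
  connectedOff⇒¬isVertexCut conn (u , v , u∉ , v∉ , ¬path) =
    ¬path (Star.map (λ (a∉ , b∉ , a~b) →
        a∉ ∘ ∈-elements⁺ , b∉ ∘ ∈-elements⁺ , a~b)
      (conn u v (u∉ ∘ ∈-elements⁻) (v∉ ∘ ∈-elements⁻)))

  -- A smaller separating `S` is compared with `L` through `elements S`, which has exactly `∣ S ∣`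
  -- entries, so that the hypothesis on shorter lists applies to it.
  independentMinimumCut : ∀ L → length L ℕ.< n →
    (∀ M → length M ℕ.< length L → ConnectedOff M) → DisconnectedOff L →
    (∀ {x y} → x ∈ L → y ∈ L → ¬ x ~ y) → HasIndependentMinimumVertexCut G
  independentMinimumCut L |L|<n conn disc indep =
    fromList L , (cut , (fromList L , inj₁ cut , refl) , minimal) ,
    λ u∈ v∈ → indep (∈-fromList⁻ u∈) (∈-fromList⁻ v∈)
    where
    cut = isVertexCut-fromList disc
    minimal : ∀ S → Separates G S → ∣ fromList L ∣ ≤ ∣ S ∣
    minimal S sep with length L ℕ.≤? ∣ S ∣
    ... | yes |L|≤|S| = ℕ.≤-trans (∣fromList∣≤length L) |L|≤|S|
    ... | no  |L|≰|S| = ⊥-elim (absurd sep)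
      where
      |S|<|L| = ℕ.≰⇒> |L|≰|S|
      absurd : ¬ Separates G S
      absurd (inj₁ cutS) = connectedOff⇒¬isVertexCut
        (conn (elements S) (subst (ℕ._< length L) (sym (length-elements S)) |S|<|L|)) cutS
      -- From `∣ S ∣ < length L < n` at least two vertices lie outside `S`, so the one-vertex
      -- alternative of `Separates` is impossible.
      absurd (inj₂ |∁S|≡1) = contradiction
        (subst (2 ≤_) (trans (sym (∣∁p∣≡n∸∣p∣ S)) |∁S|≡1)
          (ℕ.m+n≤o⇒m≤o∸n 2 (ℕ.≤-<-trans |S|<|L| |L|<n)))
        λ { (s≤s ()) }

-- Degrees

  deg : Fin n → ℕ
  deg v = ∑[ j < n ] ind (v ~? j)

  degSum : ℕ
  degSum = ∑[ i < n ] deg i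

  nbrs : Fin n → List (Fin n)
  nbrs v = filter (v ~?_) (allFin n)

  nbrs-unique : ∀ v → Unique (nbrs v)
  nbrs-unique v = filter⁺ (v ~?_) (allFin⁺ n)

  length-nbrs : ∀ v → length (nbrs v) ≡ deg v
  length-nbrs v = length-filter-tabulate (v ~?_) id

  ∈-nbrs⁺ : ∀ {v j} → v ~ j → j ∈ nbrs v
  ∈-nbrs⁺ {v} {j} = ∈-filter⁺ (v ~?_) (∈-allFin j)

  ∈-nbrs⁻ : ∀ {v j} → j ∈ nbrs v → v ~ j
  ∈-nbrs⁻ {v} = proj₂ ∘ ∈-filter⁻ (v ~?_) {xs = allFin n}

  deg-exact : ∀ {v L} → Unique L → (∀ {j} → j ∈ L → v ~ j) → (∀ {j} → v ~ j → j ∈ L) →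
    deg v ≡ length L
  deg-exact {v} {L} u L⊆ ⊆L = trans (sym (length-nbrs v)) (ℕ.≤-antisym
    (⊆-length (nbrs-unique v) (⊆L ∘ ∈-nbrs⁻)) (⊆-length u (∈-nbrs⁺ ∘ L⊆)))

  -- The second copy of the size is summed with its indices exchanged. An ordered adjacent pair is
  -- then counted exactly once, in the first copy if `i < j` and in the second if `j < i`.
  handshake : size G + size G ≡ degSum
  handshake = begin
    size G + size G
      ≡⟨ cong₂ _+_ size≡ (trans size≡ (∑-comm up)) ⟩
    (∑[ i < n ] ∑[ j < n ] up i j) + (∑[ i < n ] ∑[ j < n ] up j i)
      ≡⟨ ∑-distrib-+ (λ i → ∑[ j < n ] up i j) (λ i → ∑[ j < n ] up j i) ⟨
    (∑[ i < n ] ((∑[ j < n ] up i j) + (∑[ j < n ] up j i)))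
      ≡⟨ sum-cong-≗ (λ i → trans (sym (∑-distrib-+ (up i) (λ j → up j i)))
                                 (sum-cong-≗ (pointwise i))) ⟩
    degSum ∎
    where
    open ≡-Reasoning
    up : Fin n → Fin n → ℕ
    up i j = ind ((i <? j) ×-dec (i ~? j))
    size≡ : size G ≡ ∑[ i < n ] ∑[ j < n ] up i j
    size≡ = length-filter-cartesianProduct (λ (i , j) → (i <? j) ×-dec (i ~? j)) id id
    up-< : ∀ {i j} → i < j → up i j ≡ ind (i ~? j)
    up-< {i} {j} i<j = ind-cong ((i <? j) ×-dec (i ~? j)) (i ~? j) proj₂ (i<j ,_)
    up-≮ : ∀ {i j} → ¬ i < j → up i j ≡ 0
    up-≮ {i} {j} i≮j = ind-false ((i <? j) ×-dec (i ~? j)) (i≮j ∘ proj₁)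
    pointwise : ∀ i j → up i j + up j i ≡ ind (i ~? j)
    pointwise i j with <-cmp i j
    ... | tri< i<j _ j≮i = trans (cong₂ _+_ (up-< i<j) (up-≮ j≮i)) (+-identityʳ _)
    ... | tri> i≮j _ j<i = trans (cong₂ _+_ (up-≮ i≮j) (up-< j<i))
                             (ind-cong (j ~? i) (i ~? j) ~-sym ~-sym)
    ... | tri≈ i≮j i≡j j≮i = trans (cong₂ _+_ (up-≮ i≮j) (up-≮ j≮i))
                             (sym (ind-false (i ~? j) (~-irr i≡j)))

-- Deleting a vertex of degree two

pattern 1st = here refl
pattern 2nd = there (here refl)
pattern 3rd = there (there (here refl))

∉-pair : ∀ {A : Set} {x y z : A} → z ≢ x → z ≢ y → z ∉ x ∷ y ∷ []
∉-pair z≢x z≢y (here z≡x) = z≢x z≡x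
∉-pair z≢x z≢y (there (here z≡y)) = z≢y z≡y

deleteVertex : ∀ {n} → Graph (suc n) → Fin (suc n) → Graph n
deleteVertex G v = record
  { _~_   = λ i j → punchIn v i ~ punchIn v j
  ; _~?_  = λ i j → punchIn v i ~? punchIn v j
  ; ~-sym = ~-sym
  ; ~-irr = λ { refl → ~-irr refl }
  }
  where open Graph G

module _ {n : ℕ} (G : Graph (suc n)) (v : Fin (suc n)) where
  open Graph G

  -- In the adjacency matrix, the row and the column of `v` each contribute `deg G v`, and they meet
  -- in a zero diagonal entry.
  degSum-deleteVertex : degSum G ≡ (deg G v + deg G v) + degSum (deleteVertex G v)
  degSum-deleteVertex = begin
    degSum G
      ≡⟨ sum-remove {i = v} (deg G) ⟩
    deg G v + (∑[ i < n ] deg G (p i))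
      ≡⟨ cong (deg G v +_) (sum-cong-≗ λ i → sum-remove {i = v} (λ j → ind (p i ~? j))) ⟩
    deg G v + (∑[ i < n ] (ind (p i ~? v) + deg (deleteVertex G v) i))
      ≡⟨ cong (deg G v +_) (∑-distrib-+ (λ i → ind (p i ~? v)) (deg (deleteVertex G v))) ⟩
    deg G v + ((∑[ i < n ] ind (p i ~? v)) + degSum (deleteVertex G v))
      ≡⟨ cong (λ d → deg G v + (d + degSum (deleteVertex G v))) column ⟩
    deg G v + (deg G v + degSum (deleteVertex G v))
      ≡⟨ ℕ.+-assoc (deg G v) (deg G v) _ ⟨
    (deg G v + deg G v) + degSum (deleteVertex G v) ∎
    where
    open ≡-Reasoning
    p = punchIn v
    column : (∑[ i < n ] ind (p i ~? v)) ≡ deg G v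
    column = sym (begin
      deg G v
        ≡⟨ sum-remove {i = v} (λ j → ind (v ~? j)) ⟩
      ind (v ~? v) + (∑[ i < n ] ind (v ~? p i))
        ≡⟨ cong₂ _+_ (ind-false (v ~? v) (~-irr refl))
             (sum-cong-≗ λ i → ind-cong (v ~? p i) (p i ~? v) ~-sym ~-sym) ⟩
      (∑[ i < n ] ind (p i ~? v)) ∎)

  -- A path through v can be shortcut, since the neighbours of v form a clique.
  robust-deleteVertex : (∀ {i j} → v ~ i → v ~ j → i ≢ j → i ~ j) →
    Robust G → Robust (deleteVertex G v)
  robust-deleteVertex clique robust a b a≁b u w u∉ w∉ =
    proj₁ (Star-closed I step (robust (p a) (p b) a≁b (p u) (p w) (∉-map u∉) (∉-map w∉))
      ( (λ eq → subst (Star′ u) (punchIn-injective v _ _ (sym eq)) ε)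
      , (λ eq → contradiction eq (punchInᵢ≢i v u)))) refl
    where
    p = punchIn v
    S = a ∷ b ∷ []
    Star′ = Star (AdjOff (deleteVertex G v) S)

    ∉-map : ∀ {z} → z ∉ S → p z ∉ map p S
    ∉-map {z} z∉ pz∈ with ∈-map⁻ p pz∈
    ... | z′ , z′∈ , eq = z∉ (subst (_∈ S) (sym (punchIn-injective v z z′ eq)) z′∈)

    -- The invariant at `z`: if `z` comes from the smaller graph, its preimage is reachable there;
    -- if `z` is `v`, all surviving neighbours of `v` are reachable already. On entering `v` from
    -- `z`, the clique joins `z` to those neighbours directly.
    I : Fin (suc n) → Set
    I z = (∀ {z′} → p z′ ≡ z → Star′ u z′) × (z ≡ v → ∀ {k} → v ~ p k → k ∉ S → Star′ u k)

    step : ∀ {z t} → AdjOff G (map p S) z t → I z → I t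
    step {z} {t} (z∉ , t∉ , z~t) (old , new) = fst , snd
      where
      fst : ∀ {t′} → p t′ ≡ t → Star′ u t′
      fst {t′} refl with v ≟ z
      ... | yes refl = new refl z~t (t∉ ∘ ∈-map⁺ p)
      ... | no v≢z = old (punchIn-punchOut v≢z) ◅◅ return
              ( z∉ ∘ subst (_∈ map p S) (punchIn-punchOut v≢z) ∘ ∈-map⁺ p
              , t∉ ∘ ∈-map⁺ p
              , subst (_~ p t′) (sym (punchIn-punchOut v≢z)) z~t)
      snd : t ≡ v → ∀ {k} → v ~ p k → k ∉ S → Star′ u k
      snd refl {k} v~k k∉ with p k ≟ z
      ... | yes k≡z = old k≡z
      ... | no k≢z = old z≡ ◅◅ return
              ( z∉ ∘ subst (_∈ map p S) z≡ ∘ ∈-map⁺ p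
              , k∉
              , subst (_~ p k) (sym z≡) (clique (~-sym z~t) v~k (k≢z ∘ sym)))
        where
        z≡ : p (punchOut {i = v} {j = z} λ v≡z → ~-irr (sym v≡z) z~t) ≡ z
        z≡ = punchIn-punchOut _

-- Minimum degree and degree sum of robust graphs

module _ {n : ℕ} (G : Graph n) (robust : Robust G) where
  open Graph G

  -- Deleting `x` and `y` isolates `v`, so robustness leaves no room for a further vertex.
  closedNeighbourhood-full : ∀ {v x y} → ¬ x ~ y → v ∉ x ∷ y ∷ [] →
    (∀ {j} → v ~ j → j ∈ x ∷ y ∷ []) → ∀ w → w ∈ v ∷ x ∷ y ∷ []
  closedNeighbourhood-full {v} {x} {y} x≁y v∉ nbrs⊆ w with w ∈? (x ∷ y ∷ [])
  ... | yes w∈ = there w∈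
  ... | no  w∉ = here (sym (trapped G (robust x y x≁y) v∉ w∉ nbrs⊆))

  -- If `x` is the only possible neighbour of `v`, deleting `x` isolates `v`, and `v` and `x` would
  -- be all the vertices. An isolated `v` is treated alike, with an arbitrary other vertex as `x`.
  robust⇒2≤deg : 3 ≤ n → ∀ v → 2 ≤ deg G v
  robust⇒2≤deg 3≤n v =
    subst (2 ≤_) (length-nbrs G v) (go (nbrs G v) (∈-nbrs⁺ G) (∈-nbrs⁻ G))
    where
    few : ∀ x → x ≢ v → (∀ {j} → v ~ j → j ≡ x) → ⊥
    few x x≢v nbrs⊆ with fresh (v ∷ x ∷ []) 3≤n
    ... | w , w∉ with closedNeighbourhood-full {v} {x} {x} (~-irr refl)
                        (λ { 1st → x≢v refl ; 2nd → x≢v refl }) (here ∘ nbrs⊆) w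
    ...   | 1st = w∉ 1st
    ...   | 2nd = w∉ 2nd
    ...   | 3rd = w∉ 2nd
    go : ∀ L → (∀ {j} → v ~ j → j ∈ L) → (∀ {j} → j ∈ L → v ~ j) → 2 ≤ length L
    go [] ⊆L L⊆ with fresh (v ∷ []) (ℕ.≤-trans (s≤s (s≤s z≤n)) 3≤n)
    ... | x , x∉ = ⊥-elim (few x (x∉ ∘ here) λ v~j → contradiction (⊆L v~j) λ ())
    go (x ∷ []) ⊆L L⊆ = ⊥-elim (few x (λ { refl → ~-irr refl (L⊆ 1st) })
                          λ v~j → case⊆ (⊆L v~j))
      where
      case⊆ : ∀ {j} → j ∈ x ∷ [] → j ≡ x
      case⊆ (here eq) = eq
    go (_ ∷ _ ∷ _) _ _ = s≤s (s≤s z≤n)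

  -- Two distinct neighbours of `v` are all its neighbours. Were they non-adjacent, the graph would
  -- consist of them and `v`, three vertices in all.
  deg≤2⇒clique : 4 ≤ n → ∀ {v} → deg G v ≤ 2 →
    ∀ {i j} → v ~ i → v ~ j → i ≢ j → i ~ j
  deg≤2⇒clique 4≤n {v} deg≤2 {i} {j} v~i v~j i≢j = decidable-stable (i ~? j) λ i≁j →
    let w , w∉ = fresh (v ∷ i ∷ j ∷ []) 4≤n in
    w∉ (closedNeighbourhood-full i≁j
         (λ { 1st → ~-irr refl v~i ; 2nd → ~-irr refl v~j }) only w)
    where
    only : ∀ {k} → v ~ k → k ∈ i ∷ j ∷ []
    only {k} v~k = decidable-stable (k ∈? (i ∷ j ∷ [])) λ k∉ → contradiction
      (ℕ.≤-trans
        (⊆-length {xs = k ∷ i ∷ j ∷ []} {ys = nbrs G v}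
          (((k∉ ∘ here) ∷ (k∉ ∘ there ∘ here) ∷ []) ∷ (i≢j ∷ []) ∷ [] ∷ [])
          λ { 1st → ∈-nbrs⁺ G v~k ; 2nd → ∈-nbrs⁺ G v~i ; 3rd → ∈-nbrs⁺ G v~j })
        (subst (_≤ 2) (sym (length-nbrs G v)) deg≤2))
      λ { (s≤s (s≤s ())) }

-- Up to order six the bound is attained by K₃ with vertices of degree two attached to edges,
-- whose deficit is the term 3 ∸ n.
mutual
  robust⇒degSum≥ : ∀ n (G : Graph (3 + n)) → Robust G → (3 + n) * 3 ≤ degSum G + (3 ∸ n)
  -- At order three every degree is at least 2, and the deficit 3 makes up the difference between 6
  -- and 9.
  robust⇒degSum≥ zero G robust =
    ℕ.+-monoˡ-≤ 3 (sum-lowerBound (deg G) 2 (robust⇒2≤deg G robust ℕ.≤-refl))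
  robust⇒degSum≥ (suc n) G robust with any? (λ v → deg G v ℕ.≤? 2)
  -- The strict bound has one unit to spare, which pays for the deficit falling from `3 ∸ n` to
  -- `3 ∸ suc n`.
  ... | yes (v , deg≤2) = ℕ.s≤s⁻¹ (begin
      suc ((4 + n) * 3)              ≤⟨ robust∧deg≤2⇒degSum> n G robust deg≤2 ⟩
      degSum G + (3 ∸ n)             ≤⟨ ℕ.+-monoʳ-≤ (degSum G) (∸-suc n) ⟩
      degSum G + suc (3 ∸ suc n)     ≡⟨ ℕ.+-suc (degSum G) _ ⟩
      suc (degSum G + (3 ∸ suc n))   ∎)
    where
    open ℕ.≤-Reasoning
    ∸-suc : ∀ n → 3 ∸ n ≤ suc (3 ∸ suc n)
    ∸-suc 0 = ℕ.≤-refl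
    ∸-suc 1 = ℕ.≤-refl
    ∸-suc 2 = ℕ.≤-refl
    ∸-suc (suc (suc (suc n))) = subst (_≤ suc (3 ∸ suc (3 + n))) (sym (ℕ.0∸n≡0 n)) z≤n
  ... | no ¬deg≤2 = ℕ.≤-trans
          (sum-lowerBound (deg G) 3 λ v → ℕ.≰⇒> λ deg≤2 → ¬deg≤2 (v , deg≤2))
          (ℕ.m≤m+n (degSum G) _)

  -- Deleting `v` removes at least 4 from the degree sum, while the bound to be met falls by only 3;
  -- hence the strict inequality. From order seven on, the deficit is zero.
  robust∧deg≤2⇒degSum> : ∀ n (G : Graph (4 + n)) → Robust G → ∀ {v} → deg G v ≤ 2 →
    (4 + n) * 3 ℕ.< degSum G + (3 ∸ n)
  robust∧deg≤2⇒degSum> n G robust {v} deg≤2 = begin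
    4 + (3 + n) * 3
      ≤⟨ ℕ.+-monoʳ-≤ 4 (robust⇒degSum≥ n (deleteVertex G v)
           (robust-deleteVertex G v (deg≤2⇒clique G robust (ℕ.m≤m+n 4 n) deg≤2) robust)) ⟩
    4 + (degSum (deleteVertex G v) + (3 ∸ n))
      ≡⟨ ℕ.+-assoc 4 (degSum (deleteVertex G v)) (3 ∸ n) ⟨
    (4 + degSum (deleteVertex G v)) + (3 ∸ n)
      ≤⟨ ℕ.+-monoˡ-≤ (3 ∸ n) (ℕ.+-monoˡ-≤ (degSum (deleteVertex G v)) (ℕ.+-mono-≤ 2≤ 2≤)) ⟩
    ((deg G v + deg G v) + degSum (deleteVertex G v)) + (3 ∸ n)
      ≡⟨ cong (_+ (3 ∸ n)) (degSum-deleteVertex G v) ⟨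
    degSum G + (3 ∸ n) ∎
    where
    open ℕ.≤-Reasoning
    2≤ : 2 ≤ deg G v
    2≤ = robust⇒2≤deg G robust (ℕ.m≤m+n 3 (suc n)) v

-- Cubic graphs

module _ {n : ℕ} (G : Graph n) where
  open Graph G

  -- Naming the three neighbours turns an arbitrary neighbour of `v` into a three-way case split
  -- through `only`.
  record Neighbours (v p q r : Fin n) : Set where
    constructor neighbours
    field
      p≢q  : p ≢ q
      p≢r  : p ≢ r
      q≢r  : q ≢ r
      v~p  : v ~ p
      v~q  : v ~ q
      v~r  : v ~ r
      only : ∀ {j} → v ~ j → j ∈ p ∷ q ∷ r ∷ []

  Cubic : Set
  Cubic = ∀ v → ∃[ p ] ∃[ q ] ∃[ r ] Neighbours v p q r

  deg≡3⇒neighbours : ∀ v → deg G v ≡ 3 → ∃[ p ] ∃[ q ] ∃[ r ] Neighbours v p q r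
  deg≡3⇒neighbours v deg≡3 = go (nbrs G v) (trans (length-nbrs G v) deg≡3)
      (nbrs-unique G v) (∈-nbrs⁺ G) (∈-nbrs⁻ G)
    where
    go : ∀ L → length L ≡ 3 → Unique L → (∀ {j} → v ~ j → j ∈ L) → (∀ {j} → j ∈ L → v ~ j) →
      ∃[ p ] ∃[ q ] ∃[ r ] Neighbours v p q r
    go (p ∷ q ∷ r ∷ []) refl ((p≢q ∷ p≢r ∷ []) ∷ (q≢r ∷ []) ∷ _) ⊆L L⊆ =
      p , q , r , neighbours p≢q p≢r q≢r (L⊆ 1st) (L⊆ 2nd) (L⊆ 3rd) ⊆L

  neighbours⇒deg≡3 : ∀ {v p q r} → Neighbours v p q r → deg G v ≡ 3
  neighbours⇒deg≡3 (neighbours p≢q p≢r q≢r v~p v~q v~r only) =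
    deg-exact G ((p≢q ∷ p≢r ∷ []) ∷ (q≢r ∷ []) ∷ [] ∷ [])
      (λ { 1st → v~p ; 2nd → v~q ; 3rd → v~r }) only

  swap₁₂ : ∀ {v p q r} → Neighbours v p q r → Neighbours v q p r
  swap₁₂ (neighbours p≢q p≢r q≢r v~p v~q v~r only) =
    neighbours (p≢q ∘ sym) q≢r p≢r v~q v~p v~r λ v~j → reorder (only v~j)
    where
    reorder : ∀ {j p q r} → j ∈ p ∷ q ∷ r ∷ [] → j ∈ q ∷ p ∷ r ∷ []
    reorder 1st = 2nd
    reorder 2nd = 1st
    reorder 3rd = 3rd

  swap₂₃ : ∀ {v p q r} → Neighbours v p q r → Neighbours v p r q
  swap₂₃ (neighbours p≢q p≢r q≢r v~p v~q v~r only) =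
    neighbours p≢r p≢q (q≢r ∘ sym) v~p v~r v~q λ v~j → reorder (only v~j)
    where
    reorder : ∀ {j p q r} → j ∈ p ∷ q ∷ r ∷ [] → j ∈ p ∷ r ∷ q ∷ []
    reorder 1st = 1st
    reorder 2nd = 3rd
    reorder 3rd = 2nd

  otherTwo : Cubic → ∀ {v a} → v ~ a → ∃[ q ] ∃[ r ] Neighbours v a q r
  otherTwo cubic {v} v~a with cubic v
  ... | p , q , r , N with Neighbours.only N v~a
  ...   | 1st = q , r , N
  ...   | 2nd = p , r , swap₁₂ N
  ...   | 3rd = p , q , swap₁₂ (swap₂₃ N)

  third : Cubic → ∀ {v a b} → v ~ a → v ~ b → a ≢ b → ∃[ r ] Neighbours v a b r
  third cubic v~a v~b a≢b with otherTwo cubic v~a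
  ... | q , r , N with Neighbours.only N v~b
  ...   | 1st = contradiction refl a≢b
  ...   | 2nd = r , N
  ...   | 3rd = q , swap₂₃ N

  -- Every edge that leaves `K` ends in `L`, so a path avoiding `L` stays in `K`.
  boundary⇒disconnectedOff : ∀ {K L a w} → a ∈ K → a ∉ L → w ∉ K → w ∉ L →
    (∀ {z t} → z ∈ K → z ~ t → t ∉ L → t ∈ K) → DisconnectedOff G L
  boundary⇒disconnectedOff {K} {a = a} {w} a∈K a∉L w∉K w∉L boundary =
    a , w , a∉L , w∉L , λ path →
      w∉K (Star-closed (_∈ K) (λ (_ , t∉ , z~t) z∈ → boundary z∈ z~t t∉) path a∈K)

  disconnectedOff⇒¬connectedOff : ∀ {L} → DisconnectedOff G L → ¬ ConnectedOff G L
  disconnectedOff⇒¬connectedOff (u , v , u∉ , v∉ , ¬path) conn = ¬path (conn u v u∉ v∉)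

  -- A two-vertex cut {x , y} must be an edge.  Each of x and y has one neighbour, p and r,
  -- on the side C of the cut, so {x , r} or (if p ≡ r) {p} also separates, though it is independent.
  robust∧cubic⇒threeConnected : Robust G → Cubic → ThreeConnected G
  robust∧cubic⇒threeConnected robust cubic x y with x ~? y
  ... | no x≁y = robust x y x≁y
  ... | yes x~y with disconnectedOff? G (x ∷ y ∷ [])
  ...   | no ¬disc = ¬disconnectedOff⇒connectedOff G ¬disc
  ...   | yes (u , w , u∉ , w∉ , ¬path) = ⊥-elim impossible
    where
    Closed : Fin n → Fin n → (Fin n → Set) → Set
    Closed x y P = ∀ {z t} → P z → z ~ t → t ≢ x → t ≢ y → P t

    flip : ∀ {x y P} → Closed x y P → Closed y x P
    flip closed Pz z~t t≢y t≢x = closed Pz z~t t≢x t≢y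

    -- Each side `P` of the cut contains a neighbour of `x`: otherwise `y` alone would separate `P`
    -- from `x`, against robustness at the pair `y`, `y`.
    touch : ∀ {x y p q} → Neighbours x y p q → (P : Fin n → Set) → Closed x y P →
      ¬ P x → ¬ P y → ∀ {a} → P a → ¬ P p → ¬ P q → ⊥
    touch {x} {y} N P closed ¬Px ¬Py {a} Pa ¬Pp ¬Pq =
      ¬Px (Star-closed P step (robust y y (~-irr refl) a x
        (λ { 1st → ¬Py Pa ; 2nd → ¬Py Pa })
        (λ { 1st → ~-irr refl v~p ; 2nd → ~-irr refl v~p })) Pa)
      where
      open Neighbours N
      step : ∀ {z t} → AdjOff G (y ∷ y ∷ []) z t → P z → P t
      step {z} {t} (_ , t∉ , z~t) Pz with t ≟ x
      ... | no t≢x = closed Pz z~t t≢x (t∉ ∘ here)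
      ... | yes refl with only (~-sym z~t)
      ...   | 1st = contradiction Pz ¬Py
      ...   | 2nd = contradiction Pz ¬Pp
      ...   | 3rd = contradiction Pz ¬Pq

    C : Fin n → Set
    C = Star (AdjOff G (x ∷ y ∷ [])) u

    C? : ∀ z → Dec (C z)
    C? = star? (adjOff? G (x ∷ y ∷ [])) u

    C⇒∉ : ∀ {z} → C z → z ∉ x ∷ y ∷ []
    C⇒∉ path = Star-closed (_∉ x ∷ y ∷ []) (λ (_ , t∉ , _) _ → t∉) path u∉

    ¬Cx : ¬ C x
    ¬Cx Cx = C⇒∉ Cx 1st

    ¬Cy : ¬ C y
    ¬Cy Cy = C⇒∉ Cy 2nd

    C-closed : Closed x y C
    C-closed Cz z~t t≢x t≢y =
      Cz ◅◅ return (C⇒∉ Cz , (λ { 1st → t≢x refl ; 2nd → t≢y refl }) , z~t)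

    -- The rest of the graph without `x` and `y`; it contains `w`, so it is a nonempty second side.
    C′ : Fin n → Set
    C′ z = ¬ C z × z ≢ x × z ≢ y

    C′-closed : Closed x y C′
    C′-closed (¬Cz , z≢x , z≢y) z~t t≢x t≢y =
      (λ Ct → ¬Cz (C-closed Ct (~-sym z~t) z≢x z≢y)) , t≢x , t≢y

    ¬C′x : ¬ C′ x
    ¬C′x (_ , x≢x , _) = x≢x refl

    ¬C′y : ¬ C′ y
    ¬C′y (_ , _ , y≢y) = y≢y refl

    -- Apart from `y`, the vertex `x` has only two neighbours, and both sides must be touched. Hence
    -- exactly one of the two lies in `C`.
    split : ∀ {x y p q} → Neighbours x y p q → Closed x y C → ¬ C x → ¬ C y →
      Closed x y C′ → ¬ C′ x → ¬ C′ y → ∃[ p ] ∃[ q ] (Neighbours x y p q × C p × ¬ C q)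
    split {p = p} {q} N closed ¬Cx ¬Cy closed′ ¬C′x ¬C′y with C? p | C? q
    ... | yes Cp | no ¬Cq = p , q , N , Cp , ¬Cq
    ... | no ¬Cp | yes Cq = q , p , swap₂₃ N , Cq , ¬Cp
    ... | no ¬Cp | no ¬Cq = ⊥-elim (touch N C closed ¬Cx ¬Cy ε ¬Cp ¬Cq)
    ... | yes Cp | yes Cq = ⊥-elim (touch N C′ closed′ ¬C′x ¬C′y {w}
            (¬path , w∉ ∘ here , w∉ ∘ there ∘ here)
            (λ (¬Cp , _) → ¬Cp Cp) (λ (¬Cq , _) → ¬Cq Cq))

    impossible : ⊥
    impossible with otherTwo cubic x~y | otherTwo cubic (~-sym x~y)
    ... | _ , _ , Nx | _ , _ , Ny 
      with split Nx C-closed ¬Cx ¬Cy C′-closed ¬C′x ¬C′y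
         | split Ny (flip C-closed) ¬Cy ¬Cx (flip C′-closed) ¬C′y ¬C′x
    ... | p , q , Nx , Cp , ¬Cq | r , s , Ny , Cr , ¬Cs with p ≟ r
    -- Here `p` is the only way from `x` or `y` into `C`. Its third neighbour `t` also lies in `C`,
    -- so something is left there for `p` to cut off.
    ...   | yes refl = ¬Cx (Star-closed C step
              (robust p p (~-irr refl) t x
                (∉-pair t≢p t≢p)
                (λ { 1st → ~-irr refl v~p ; 2nd → ~-irr refl v~p })) Ct)
      where
      Np = third cubic (~-sym (Neighbours.v~q Nx)) (~-sym (Neighbours.v~q Ny))
             (λ x≡y → ~-irr x≡y x~y)
      t = proj₁ Np
      open Neighbours (proj₂ Np)
      t≢p : t ≢ p
      t≢p t≡p = ~-irr (sym t≡p) v~r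
      Ct : C t
      Ct = C-closed Cp v~r (p≢r ∘ sym) (q≢r ∘ sym)
      step : ∀ {z t} → AdjOff G (p ∷ p ∷ []) z t → C z → C t
      step {z} {t} (z∉ , t∉ , z~t) Cz with t ≟ x | t ≟ y
      ... | no t≢x | no t≢y = C-closed Cz z~t t≢x t≢y
      ... | yes refl | _ with Neighbours.only Nx (~-sym z~t)
      ...   | 1st = contradiction Cz ¬Cy
      ...   | 2nd = contradiction 1st z∉
      ...   | 3rd = contradiction Cz ¬Cq
      step {z} {t} (z∉ , t∉ , z~t) Cz | no _ | yes refl with Neighbours.only Ny (~-sym z~t)
      ...   | 1st = contradiction Cz ¬Cx
      ...   | 2nd = contradiction 1st z∉
      ...   | 3rd = contradiction Cz ¬Cs
    -- Since `x` meets `C` only in `p`, it is not adjacent to `r`. Once `x` and `r` are deleted, `y`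
    -- has no neighbour left in `C`, while `p` is still there.
    ...   | no p≢r = ¬Cy (Star-closed C step
              (robust x r x≁r p y
                (λ { 1st → ¬Cx Cp ; 2nd → p≢r refl })
                (λ { 1st → ~-irr refl x~y ; 2nd → ¬Cy Cr })) Cp)
      where
      x≁r : ¬ x ~ r
      x≁r x~r with Neighbours.only Nx x~r
      ... | 1st = ¬Cy Cr
      ... | 2nd = p≢r refl
      ... | 3rd = ¬Cq Cr
      step : ∀ {z t} → AdjOff G (x ∷ r ∷ []) z t → C z → C t
      step {z} {t} (z∉ , t∉ , z~t) Cz with t ≟ y
      ... | no t≢y = C-closed Cz z~t (t∉ ∘ here) t≢y
      ... | yes refl with Neighbours.only Ny (~-sym z~t)
      ...   | 1st = contradiction Cz ¬Cx
      ...   | 2nd = contradiction 2nd z∉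
      ...   | 3rd = contradiction Cz ¬Cs

  -- A single vertex is treated as a pair with equal entries. The condition concerns pairs from `M`
  -- only, so it follows from robustness when `M` is independent, as well as from 3-connectivity.
  connectedOff-short : Connected G → ∀ M → length M ℕ.< 3 →
    (∀ {x y} → x ∈ M → y ∈ M → ConnectedOff G (x ∷ y ∷ [])) → ConnectedOff G M
  connectedOff-short connected [] _ _ u v _ _ =
    Star.map (λ u~v → (λ ()) , (λ ()) , u~v) (connected u v)
  connectedOff-short _ (x ∷ []) _ conn =
    connectedOff-resp G {x ∷ x ∷ []} (λ { 1st → 1st ; 2nd → 1st }) there (conn 1st 1st)
  connectedOff-short _ (x ∷ y ∷ []) _ conn = conn 1st 2nd
  connectedOff-short _ (_ ∷ _ ∷ _ ∷ _) (s≤s (s≤s (s≤s ()))) _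

  independent-triple : ∀ {a b c} → ¬ a ~ b → ¬ a ~ c → ¬ b ~ c →
    ∀ {x y} → x ∈ a ∷ b ∷ c ∷ [] → y ∈ a ∷ b ∷ c ∷ [] → ¬ x ~ y
  independent-triple a≁b a≁c b≁c 1st 1st = ~-irr refl
  independent-triple a≁b a≁c b≁c 1st 2nd = a≁b
  independent-triple a≁b a≁c b≁c 1st 3rd = a≁c
  independent-triple a≁b a≁c b≁c 2nd 1st = a≁b ∘ ~-sym
  independent-triple a≁b a≁c b≁c 2nd 2nd = ~-irr refl
  independent-triple a≁b a≁c b≁c 2nd 3rd = b≁c
  independent-triple a≁b a≁c b≁c 3rd 1st = a≁c ∘ ~-sym
  independent-triple a≁b a≁c b≁c 3rd 2nd = b≁c ∘ ~-sym
  independent-triple a≁b a≁c b≁c 3rd 3rd = ~-irr refl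

  -- Independent cuts in 3-connected cubic graphs

  module _ (7≤n : 7 ≤ n) (connected : Connected G) (cubic : Cubic) (conn : ThreeConnected G) where

    independentTriple⇒independentMinimumCut : ∀ {a b c} → ¬ a ~ b → ¬ a ~ c → ¬ b ~ c →
      DisconnectedOff G (a ∷ b ∷ c ∷ []) → HasIndependentMinimumVertexCut G
    independentTriple⇒independentMinimumCut a≁b a≁c b≁c disc =
      independentMinimumCut G _ (ℕ.≤-trans (s≤s (s≤s (s≤s (s≤s z≤n)))) 7≤n)
        (λ M |M|<3 → connectedOff-short connected M |M|<3 λ {x} {y} _ _ → conn x y)
        disc (independent-triple a≁b a≁c b≁c)

    -- A common third neighbour of `a` and `b` would, together with `c`, cut these two off from a
    -- fifth vertex, against 3-connectivity.
    outerDistinct : ∀ {a b c a′ b′} → Neighbours a b c a′ → Neighbours b a c b′ → a′ ≢ b′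
    outerDistinct {a} {b} {c} {a′} Na Nb refl
      with fresh (a ∷ b ∷ c ∷ a′ ∷ []) (ℕ.≤-trans (s≤s (s≤s (s≤s (s≤s (s≤s z≤n))))) 7≤n)
    ... | w , w∉ = disconnectedOff⇒¬connectedOff
            (boundary⇒disconnectedOff {a ∷ b ∷ []} {c ∷ a′ ∷ []} {a} {w} 1st
              (λ { 1st → ~-irr refl A.v~q ; 2nd → ~-irr refl A.v~r })
              (λ { 1st → w∉ 1st ; 2nd → w∉ 2nd })
              (w∉ ∘ there ∘ there) boundary)
            (conn c a′)
      where
      module A = Neighbours Na
      module B = Neighbours Nb
      boundary : ∀ {z t} → z ∈ a ∷ b ∷ [] → z ~ t → t ∉ c ∷ a′ ∷ [] → t ∈ a ∷ b ∷ []
      boundary 1st a~t t∉ with A.only a~t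
      ... | 1st = 2nd
      ... | 2nd = contradiction 1st t∉
      ... | 3rd = contradiction 2nd t∉
      boundary 2nd b~t t∉ with B.only b~t
      ... | 1st = 1st
      ... | 2nd = contradiction 1st t∉
      ... | 3rd = contradiction 2nd t∉

    -- The neighbours of `b` and `c` outside this pair are `a`, `b′` and `c′`, so deleting these
    -- three separates the pair from `a′`. By `outerDistinct`, `a′` survives and `a` is adjacent to
    -- neither `b′` nor `c′`.
    triangleCut : ∀ {a b c a′ b′ c′} →
      Neighbours a b c a′ → Neighbours b a c b′ → Neighbours c a b c′ → ¬ b′ ~ c′ →
      HasIndependentMinimumVertexCut G
    triangleCut {a} {b} {c} {a′} {b′} {c′} Na Nb Nc b′≁c′ =
      independentTriple⇒independentMinimumCut {a} {b′} {c′} a≁b′ a≁c′ b′≁c′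
        (boundary⇒disconnectedOff {b ∷ c ∷ []} {a ∷ b′ ∷ c′ ∷ []} {b} {a′} 1st
          (λ { 1st → ~-irr refl A.v~p ; 2nd → ~-irr refl B.v~r ; 3rd → C.q≢r refl })
          (λ { 1st → A.p≢r refl ; 2nd → A.q≢r refl })
          (λ { 1st → ~-irr refl A.v~r ; 2nd → a′≢b′ refl ; 3rd → a′≢c′ refl })
          boundary)
      where
      module A = Neighbours Na
      module B = Neighbours Nb
      module C = Neighbours Nc
      a′≢b′ : a′ ≢ b′
      a′≢b′ = outerDistinct Na Nb
      a′≢c′ : a′ ≢ c′
      a′≢c′ = outerDistinct (swap₁₂ Na) Nc
      a≁b′ : ¬ a ~ b′
      a≁b′ a~b′ with A.only a~b′
      ... | 1st = ~-irr refl B.v~r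
      ... | 2nd = B.q≢r refl
      ... | 3rd = a′≢b′ refl
      a≁c′ : ¬ a ~ c′
      a≁c′ a~c′ with A.only a~c′
      ... | 1st = C.q≢r refl
      ... | 2nd = ~-irr refl C.v~r
      ... | 3rd = a′≢c′ refl
      boundary : ∀ {z t} → z ∈ b ∷ c ∷ [] → z ~ t → t ∉ a ∷ b′ ∷ c′ ∷ [] → t ∈ b ∷ c ∷ []
      boundary 1st b~t t∉ with B.only b~t
      ... | 1st = contradiction 1st t∉
      ... | 2nd = 2nd
      ... | 3rd = contradiction 2nd t∉
      boundary 2nd c~t t∉ with C.only c~t
      ... | 1st = contradiction 1st t∉
      ... | 2nd = 1st
      ... | 3rd = contradiction 3rd t∉

    -- Each of the six vertices has all its three neighbours among them, so by connectedness a
    -- seventh vertex cannot exist.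
    ¬prism : ∀ {a b c a′ b′ c′} →
      Neighbours a b c a′ → Neighbours b a c b′ → Neighbours c a b c′ →
      a′ ~ b′ → a′ ~ c′ → b′ ~ c′ → ⊥
    ¬prism {a} {b} {c} {a′} {b′} {c′} Na Nb Nc a′~b′ a′~c′ b′~c′
      with fresh (a ∷ b ∷ c ∷ a′ ∷ b′ ∷ c′ ∷ []) 7≤n
    ... | w , w∉ = w∉ (Star-closed (_∈ K) (λ z~t z∈ → closed z∈ z~t) (connected a w) 1st)
      where
      module A = Neighbours Na
      module B = Neighbours Nb
      module C = Neighbours Nc
      K = a ∷ b ∷ c ∷ a′ ∷ b′ ∷ c′ ∷ []
      outer : ∀ {d d′ e′ f′ t} → Neighbours d′ d e′ f′ → d ∈ K → e′ ∈ K → f′ ∈ K → d′ ~ t → t ∈ K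
      outer N d∈ e∈ f∈ d′~t with Neighbours.only N d′~t
      ... | 1st = d∈
      ... | 2nd = e∈
      ... | 3rd = f∈
      outerNbrs : ∀ {d d′ e′ f′} → d ≢ e′ → e′ ≢ f′ → d′ ~ d → d′ ~ e′ → d′ ~ f′ → d ≢ f′ →
        Neighbours d′ d e′ f′
      outerNbrs d≢e′ e′≢f′ d′~d d′~e′ d′~f′ d≢f′ with third cubic d′~d d′~e′ d≢e′
      ... | r , N with Neighbours.only N d′~f′
      ...   | 1st = contradiction refl d≢f′
      ...   | 2nd = contradiction refl e′≢f′
      ...   | 3rd = N
      closed : ∀ {z t} → z ∈ K → z ~ t → t ∈ K
      closed 1st a~t = outer Na 2nd 3rd (there (there (there 1st))) a~t
      closed 2nd b~t = outer Nb 1st 3rd (there (there (there 2nd))) b~t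
      closed 3rd c~t = outer Nc 1st 2nd (there (there (there 3rd))) c~t
      closed (there (there (there 1st))) a′~t =
        outer (outerNbrs (B.p≢r) (λ b′≡c′ → ~-irr b′≡c′ b′~c′) (~-sym A.v~r) a′~b′ a′~c′ C.p≢r)
          1st (there (there (there 2nd))) (there (there (there 3rd))) a′~t
      closed (there (there (there 2nd))) b′~t =
        outer (outerNbrs (A.p≢r) (λ a′≡c′ → ~-irr a′≡c′ a′~c′) (~-sym B.v~r) (~-sym a′~b′) b′~c′ C.q≢r)
          2nd (there (there (there 1st))) (there (there (there 3rd))) b′~t
      closed (there (there (there 3rd))) c′~t =
        outer (outerNbrs (A.q≢r) (λ a′≡b′ → ~-irr a′≡b′ a′~b′) (~-sym C.v~r) (~-sym a′~c′) (~-sym b′~c′) B.q≢r)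
          3rd (there (there (there 1st))) (there (there (there 2nd))) c′~t

    triangle⇒independentMinimumCut : ∀ {a b c} → a ~ b → a ~ c → b ~ c →
      HasIndependentMinimumVertexCut G
    triangle⇒independentMinimumCut {a} {b} {c} a~b a~c b~c
      with third cubic a~b a~c (λ b≡c → ~-irr b≡c b~c)
         | third cubic (~-sym a~b) b~c (λ a≡c → ~-irr a≡c a~c)
         | third cubic (~-sym a~c) (~-sym b~c) (λ a≡b → ~-irr a≡b a~b)
    ... | a′ , Na | b′ , Nb | c′ , Nc with a′ ~? b′ | a′ ~? c′ | b′ ~? c′
    -- The triangle is relabelled so that the cut contains the corner opposite to the non-adjacent
    -- pair of third neighbours.
    ...   | _ | _ | no b′≁c′ = triangleCut Na Nb Nc b′≁c′
    ...   | _ | no a′≁c′ | _ = triangleCut Nb Na (swap₁₂ Nc) a′≁c′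
    ...   | no a′≁b′ | _ | _ = triangleCut Nc (swap₁₂ Na) (swap₁₂ Nb) a′≁b′
    ...   | yes a′~b′ | yes a′~c′ | yes b′~c′ = ⊥-elim (¬prism Na Nb Nc a′~b′ a′~c′ b′~c′)

    threeConnected∧cubic⇒independentMinimumCut : Fin n → HasIndependentMinimumVertexCut G
    threeConnected∧cubic⇒independentMinimumCut v with cubic v
    ... | p , q , r , N with p ~? q | p ~? r | q ~? r
    ...   | yes p~q | _ | _ = triangle⇒independentMinimumCut (Neighbours.v~p N) (Neighbours.v~q N) p~q
    ...   | _ | yes p~r | _ = triangle⇒independentMinimumCut (Neighbours.v~p N) (Neighbours.v~r N) p~r
    ...   | _ | _ | yes q~r = triangle⇒independentMinimumCut (Neighbours.v~q N) (Neighbours.v~r N) q~r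
    -- The neighbourhood of `v` is independent; deleting it isolates `v` from the surviving `w`.
    ...   | no p≁q | no p≁r | no q≁r
      with fresh (v ∷ p ∷ q ∷ r ∷ []) (ℕ.≤-trans (s≤s (s≤s (s≤s (s≤s (s≤s z≤n))))) 7≤n)
    ...     | w , w∉ = independentTriple⇒independentMinimumCut p≁q p≁r q≁r
                (boundary⇒disconnectedOff {v ∷ []} {p ∷ q ∷ r ∷ []} {v} {w} 1st
                  (λ { 1st → ~-irr refl v~p ; 2nd → ~-irr refl v~q ; 3rd → ~-irr refl v~r })
                  (λ { 1st → w∉ 1st }) (w∉ ∘ there)
                  λ { 1st v~t t∉ → contradiction (only v~t) t∉ })
      where open Neighbours N

-- Graphs with few edges

fewEdges⇒independentMinimumCut : ∀ n → 7 ≤ n → (G : Graph n) → Connected G →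
  size G ≤ (3 * n) / 2 → HasIndependentMinimumVertexCut G
fewEdges⇒independentMinimumCut n 7≤n G connected size≤
  with any? (λ x → disconnectedOff? G (x ∷ []))
... | yes (x , disc) =
        independentMinimumCut G (x ∷ []) (ℕ.≤-trans (s≤s (s≤s z≤n)) 7≤n)
          (λ { [] _ → connectedOff-short G connected [] (s≤s z≤n) λ ()
             ; (_ ∷ _) (s≤s ()) })
          disc (λ { 1st 1st → Graph.~-irr G refl })
... | no noCutVertex
  -- The search admits `x ≡ y`, so its failure is exactly `Robust G`.
  with any? (λ x → any? λ y → ¬? (Graph._~?_ G x y) ×-dec disconnectedOff? G (x ∷ y ∷ []))
...   | yes (x , y , x≁y , disc) =
          independentMinimumCut G (x ∷ y ∷ []) (ℕ.≤-trans (s≤s (s≤s (s≤s z≤n))) 7≤n)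
            (λ { [] _ → connectedOff-short G connected [] (s≤s z≤n) λ ()
               ; (w ∷ []) _ → ¬disconnectedOff⇒connectedOff G λ d → noCutVertex (w , d)
               ; (_ ∷ _ ∷ _) (s≤s (s≤s ())) })
            disc
            (λ { 1st 1st → ~-irr refl ; 1st 2nd → x≁y
               ; 2nd 1st → x≁y ∘ ~-sym ; 2nd 2nd → ~-irr refl })
  where open Graph G
...   | no noIndependentPair with ℕ.m≤n⇒∃[o]m+o≡n 7≤n
...     | k , refl = threeConnected∧cubic⇒independentMinimumCut G 7≤n connected cubic
            (robust∧cubic⇒threeConnected G robust cubic) zero
  where
  robust : Robust G
  robust x y x≁y = ¬disconnectedOff⇒connectedOff G λ d → noIndependentPair (x , y , x≁y , d)

  degSum≤ : degSum G ≤ n * 3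
  degSum≤ = begin
    degSum G             ≡⟨ handshake G ⟨
    size G + size G      ≡⟨ cong (size G +_) (+-identityʳ (size G)) ⟨
    2 * size G           ≤⟨ ℕ.*-monoʳ-≤ 2 size≤ ⟩
    2 * ((3 * n) / 2)    ≡⟨ ℕ.*-comm 2 ((3 * n) / 2) ⟩
    (3 * n) / 2 * 2      ≤⟨ m/n*n≤m (3 * n) 2 ⟩
    3 * n                ≡⟨ ℕ.*-comm 3 n ⟩
    n * 3                ∎
    where open ℕ.≤-Reasoning

  -- With `n = 4 + (3 + k)` the deficit is zero, so a vertex of degree at most 2 would push the
  -- degree sum above `n * 3`.
  3≤deg : ∀ v → 3 ≤ deg G v
  3≤deg v = ℕ.≰⇒> λ deg≤2 → contradiction
    (subst (n * 3 ℕ.<_) (trans (cong (degSum G +_) (ℕ.0∸n≡0 k)) (+-identityʳ (degSum G)))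
      (robust∧deg≤2⇒degSum> (3 + k) G robust deg≤2))
    (ℕ.≤⇒≯ degSum≤)

  cubic : Cubic G
  cubic v = deg≡3⇒neighbours G v (sum-tight (deg G) 3 3≤deg degSum≤ v)

-- Extremal graphs

-- Connectivity is pushed forward along `f`: edges become paths, and every remaining vertex of `H`
-- walks to the image of a remaining vertex of `G`. Both constructions below rest on this.
connectedOff-via : ∀ {m n} (G : Graph m) (H : Graph n) (f : Fin m → Fin n) {K L} →
  ConnectedOff G K →
  (∀ {i j} → AdjOff G K i j → Star (AdjOff H L) (f i) (f j)) →
  (∀ z → z ∉ L → ∃[ i ] (i ∉ K × Star (AdjOff H L) z (f i))) →
  ConnectedOff H L
connectedOff-via G H f conn lift home u w u∉ w∉ =
  let i , i∉ , u⇝fi = home u u∉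
      j , j∉ , w⇝fj = home w w∉
  in u⇝fi ◅◅ kleisliStar f lift (conn i j i∉ j∉) ◅◅ reverse (AdjOff-sym H) w⇝fj

connectedOff-swap : ∀ {n} (G : Graph n) {x y} →
  ConnectedOff G (x ∷ y ∷ []) → ConnectedOff G (y ∷ x ∷ [])
connectedOff-swap G {x} {y} =
  connectedOff-resp G {x ∷ y ∷ []} {y ∷ x ∷ []}
    (λ { 1st → 2nd ; 2nd → 1st }) (λ { 1st → 2nd ; 2nd → 1st })

robust⇒connected : ∀ {n} (G : Graph n) → 3 ≤ n → Robust G → Connected G
robust⇒connected G 3≤n robust u v with fresh (u ∷ v ∷ []) 3≤n
... | w , w∉ = Star.map (λ (_ , _ , a~b) → a~b)
        (robust w w (Graph.~-irr G refl) u v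
          (λ { 1st → w∉ 1st ; 2nd → w∉ 1st }) (λ { 1st → w∉ 2nd ; 2nd → w∉ 2nd }))

-- Joining a new vertex to both ends of an edge

module Attach {n : ℕ} (G : Graph n) (x y : Fin n) (x~y : Graph._~_ G x y) where
  open Graph G

  attach : Graph (suc n)
  attach = record { _~_ = _~′_ ; _~?_ = _~?′_ ; ~-sym = λ {i} {j} → sym′ i j ; ~-irr = λ { {i} refl → irr′ i } }
    where
    _~′_ : Rel (Fin (suc n)) 0ℓ
    zero  ~′ zero  = ⊥
    zero  ~′ suc j = j ≡ x ⊎ j ≡ y
    suc i ~′ zero  = i ≡ x ⊎ i ≡ y
    suc i ~′ suc j = i ~ j
    _~?′_ : Decidable _~′_
    zero  ~?′ zero  = no λ ()
    zero  ~?′ suc j = (j ≟ x) ⊎-dec (j ≟ y)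
    suc i ~?′ zero  = (i ≟ x) ⊎-dec (i ≟ y)
    suc i ~?′ suc j = i ~? j
    sym′ : ∀ i j → i ~′ j → j ~′ i
    sym′ zero    (suc j) p = p
    sym′ (suc i) zero    p = p
    sym′ (suc i) (suc j) p = ~-sym p
    irr′ : ∀ i → ¬ i ~′ i
    irr′ (suc i) = ~-irr refl

  apex-only : ∀ {j} → Graph._~_ attach zero j → j ∈ suc x ∷ suc y ∷ []
  apex-only {suc j} (inj₁ refl) = 1st
  apex-only {suc j} (inj₂ refl) = 2nd

  -- Deleting the new vertex, of degree two, gives back `G` by computation.
  degSum-attach : degSum attach ≡ 4 + degSum G
  degSum-attach = trans (degSum-deleteVertex attach zero)
    (cong (λ d → (d + d) + degSum G)
      (deg-exact attach {zero} {suc x ∷ suc y ∷ []}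
        (((λ { refl → ~-irr refl x~y }) ∷ []) ∷ [] ∷ [])
        (λ { 1st → inj₁ refl ; 2nd → inj₂ refl })
        apex-only))

  -- A non-adjacent pair of old vertices misses an end of the edge `x y`, and the new vertex stays
  -- attached there. If the new vertex is itself deleted, at most one vertex of `G` goes with it,
  -- and `G` has no cut vertex.
  robust-attach : 3 ≤ n → Robust G → Robust attach
  robust-attach 3≤n robust zero zero _ =
    connectedOff-via G attach suc {[]}
      (connectedOff-short G (robust⇒connected G 3≤n robust) [] (s≤s z≤n) λ ())
      (λ (_ , _ , i~j) → return (∉-pair (λ ()) (λ ()) , ∉-pair (λ ()) (λ ()) , i~j))
      λ { zero 0∉ → contradiction 1st 0∉ ; (suc i) _ → i , (λ ()) , ε }
  robust-attach 3≤n robust zero (suc b) _ =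
    connectedOff-via G attach suc {b ∷ b ∷ []} (robust b b (~-irr refl))
      (λ (i∉ , j∉ , i~j) → return
        ( ∉-pair (λ ()) (λ { refl → i∉ 1st }) , ∉-pair (λ ()) (λ { refl → j∉ 1st }) , i~j))
      λ { zero 0∉ → contradiction 1st 0∉
        ; (suc i) si∉ → i , (λ { 1st → si∉ 2nd ; 2nd → si∉ 2nd }) , ε }
  robust-attach 3≤n robust (suc a) zero a≁0 =
    connectedOff-swap attach (robust-attach 3≤n robust zero (suc a) a≁0)
  robust-attach 3≤n robust (suc a) (suc b) a≁b =
    connectedOff-via G attach suc {a ∷ b ∷ []} (robust a b a≁b)
      (λ (i∉ , j∉ , i~j) → return (∉-suc i∉ , ∉-suc j∉ , i~j))
      home
    where
    ∉-suc : ∀ {i} → i ∉ a ∷ b ∷ [] → suc i ∉ suc a ∷ suc b ∷ []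
    ∉-suc i∉ = ∉-pair (λ { refl → i∉ 1st }) (λ { refl → i∉ 2nd })
    0∉ : zero ∉ suc a ∷ suc b ∷ []
    0∉ = ∉-pair (λ ()) (λ ())
    edge⊈ : x ∈ a ∷ b ∷ [] → y ∉ a ∷ b ∷ []
    edge⊈ 1st 1st = ~-irr refl x~y
    edge⊈ 1st 2nd = a≁b x~y
    edge⊈ 2nd 1st = a≁b (~-sym x~y)
    edge⊈ 2nd 2nd = ~-irr refl x~y
    home : ∀ z → z ∉ suc a ∷ suc b ∷ [] →
      ∃[ i ] (i ∉ a ∷ b ∷ [] × Star (AdjOff attach (suc a ∷ suc b ∷ [])) z (suc i))
    home (suc i) si∉ = i , (λ { 1st → si∉ 1st ; 2nd → si∉ 2nd }) , ε
    home zero _ with x ∈? (a ∷ b ∷ [])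
    ... | no x∉ = x , x∉ , return (0∉ , ∉-suc x∉ , inj₁ refl)
    ... | yes x∈ = y , edge⊈ x∈ , return (0∉ , ∉-suc (edge⊈ x∈) , inj₂ refl)

  -- The ends of the edge cut off the new vertex, so a minimum cut has at most two vertices. If it
  -- were independent, robustness would keep the rest connected.
  ¬independentMinimumCut-attach : 3 ≤ n → Robust G → ¬ HasIndependentMinimumVertexCut attach
  ¬independentMinimumCut-attach 3≤n robust (S , (cut , _ , minimal) , indep) =
    connectedOff⇒¬isVertexCut attach
      (connectedOff-short attach (robust⇒connected attach (ℕ.m≤n⇒m≤1+n 3≤n) robust′) (elements S)
        (s≤s (subst (_≤ 2) (sym (length-elements S)) |S|≤2))
        λ {a} {b} a∈ b∈ → robust′ a b (indep (∈-elements⁻ a∈) (∈-elements⁻ b∈)))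
      cut
    where
    robust′ : Robust attach
    robust′ = robust-attach 3≤n robust
    disc : DisconnectedOff attach (suc x ∷ suc y ∷ [])
    disc with fresh (zero ∷ suc x ∷ suc y ∷ []) (s≤s 3≤n)
    ... | w , w∉ = boundary⇒disconnectedOff attach {zero ∷ []} {suc x ∷ suc y ∷ []} {zero} {w} 1st
            (∉-pair (λ ()) (λ ())) (λ { 1st → w∉ 1st }) (w∉ ∘ there)
            λ { 1st 0~t t∉ → contradiction (apex-only 0~t) t∉ }
    |S|≤2 : ∣ S ∣ ≤ 2
    |S|≤2 = ℕ.≤-trans (minimal _ (inj₁ (isVertexCut-fromList attach disc)))
              (∣fromList∣≤length (suc x ∷ suc y ∷ []))

-- Truncating a vertex of a cubic graph

module Truncate {n : ℕ} (G : Graph n) {v p q r : Fin n} (N : Neighbours G v p q r) where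
  open Graph G
  open Neighbours N

  -- The vertex v becomes a triangle, with corners 0, 1 and v taking over p, q and r.
  truncate : Graph (2 + n)
  truncate = record { _~_ = _~′_ ; _~?_ = _~?′_ ; ~-sym = λ {i} {j} → sym′ i j ; ~-irr = λ { {i} refl → irr′ i } }
    where
    _~′_ : Rel (Fin (2 + n)) 0ℓ
    zero        ~′ zero        = ⊥
    zero        ~′ suc zero    = ⊤
    zero        ~′ suc (suc j) = j ≡ v ⊎ j ≡ p
    suc zero    ~′ zero        = ⊤
    suc zero    ~′ suc zero    = ⊥
    suc zero    ~′ suc (suc j) = j ≡ v ⊎ j ≡ q
    suc (suc i) ~′ zero        = i ≡ v ⊎ i ≡ p
    suc (suc i) ~′ suc zero    = i ≡ v ⊎ i ≡ q
    -- The two implications drop the edges from `v` to `p` and `q`, so that the corner `v` keeps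
    -- only `r`.
    suc (suc i) ~′ suc (suc j) = i ~ j × (i ≡ v → j ≡ r) × (j ≡ v → i ≡ r)
    _~?′_ : Decidable _~′_
    zero        ~?′ zero        = no λ ()
    zero        ~?′ suc zero    = yes tt
    zero        ~?′ suc (suc j) = (j ≟ v) ⊎-dec (j ≟ p)
    suc zero    ~?′ zero        = yes tt
    suc zero    ~?′ suc zero    = no λ ()
    suc zero    ~?′ suc (suc j) = (j ≟ v) ⊎-dec (j ≟ q)
    suc (suc i) ~?′ zero        = (i ≟ v) ⊎-dec (i ≟ p)
    suc (suc i) ~?′ suc zero    = (i ≟ v) ⊎-dec (i ≟ q)
    suc (suc i) ~?′ suc (suc j) =
      (i ~? j) ×-dec ((i ≟ v) →-dec (j ≟ r)) ×-dec ((j ≟ v) →-dec (i ≟ r))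
    sym′ : ∀ i j → i ~′ j → j ~′ i
    sym′ zero          (suc zero)    e = e
    sym′ zero          (suc (suc j)) e = e
    sym′ (suc zero)    zero          e = e
    sym′ (suc zero)    (suc (suc j)) e = e
    sym′ (suc (suc i)) zero          e = e
    sym′ (suc (suc i)) (suc zero)    e = e
    sym′ (suc (suc i)) (suc (suc j)) (i~j , i≡v⇒ , j≡v⇒) = ~-sym i~j , j≡v⇒ , i≡v⇒
    irr′ : ∀ i → ¬ i ~′ i
    irr′ (suc (suc i)) (i~i , _) = ~-irr refl i~i

  open Graph truncate using () renaming (_~_ to _~′_; ~-sym to ~′-sym; ~-irr to ~′-irr)

  old : Fin n → Fin (2 + n)
  old i = suc (suc i)

  old-injective : ∀ {i j} → old i ≡ old j → i ≡ j
  old-injective refl = refl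

  -- Indexing by `Fin 3` hides the asymmetry between the two new vertices and the reused `v`, so the
  -- corners can be treated uniformly.
  corner : Fin 3 → Fin (2 + n)
  corner zero             = zero
  corner (suc zero)       = suc zero
  corner (suc (suc zero)) = old v

  outer : Fin 3 → Fin n
  outer zero             = p
  outer (suc zero)       = q
  outer (suc (suc zero)) = r

  data View : Fin (2 + n) → Set where
    isCorner : ∀ c → View (corner c)
    isOld    : ∀ i → i ≢ v → View (old i)

  view : ∀ z → View z
  view zero       = isCorner zero
  view (suc zero) = isCorner (suc zero)
  view (suc (suc i)) with i ≟ v
  ... | yes refl = isCorner (suc (suc zero))
  ... | no i≢v   = isOld i i≢v

  v~outer : ∀ c → v ~ outer c
  v~outer zero             = v~p
  v~outer (suc zero)       = v~q
  v~outer (suc (suc zero)) = v~r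

  outer≢v : ∀ c → outer c ≢ v
  outer≢v c eq = ~-irr (sym eq) (v~outer c)

  outer-injective : ∀ c d → outer c ≡ outer d → c ≡ d
  outer-injective zero             zero             _  = refl
  outer-injective zero             (suc zero)       eq = contradiction eq p≢q
  outer-injective zero             (suc (suc zero)) eq = contradiction eq p≢r
  outer-injective (suc zero)       zero             eq = contradiction (sym eq) p≢q
  outer-injective (suc zero)       (suc zero)       _  = refl
  outer-injective (suc zero)       (suc (suc zero)) eq = contradiction eq q≢r
  outer-injective (suc (suc zero)) zero             eq = contradiction (sym eq) p≢r
  outer-injective (suc (suc zero)) (suc zero)       eq = contradiction (sym eq) q≢r
  outer-injective (suc (suc zero)) (suc (suc zero)) _  = refl

  outer-surjective : ∀ {j} → v ~ j → ∃[ c ] j ≡ outer c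
  outer-surjective v~j with only v~j
  ... | 1st = zero , refl
  ... | 2nd = suc zero , refl
  ... | 3rd = suc (suc zero) , refl

  corner~corner : ∀ c d → c ≢ d → corner c ~′ corner d
  corner~corner zero             zero             c≢d = contradiction refl c≢d
  corner~corner zero             (suc zero)       _   = tt
  corner~corner zero             (suc (suc zero)) _   = inj₁ refl
  corner~corner (suc zero)       zero             _   = tt
  corner~corner (suc zero)       (suc zero)       c≢d = contradiction refl c≢d
  corner~corner (suc zero)       (suc (suc zero)) _   = inj₁ refl
  corner~corner (suc (suc zero)) zero             _   = inj₁ refl
  corner~corner (suc (suc zero)) (suc zero)       _   = inj₁ refl
  corner~corner (suc (suc zero)) (suc (suc zero)) c≢d = contradiction refl c≢d

  corner~outer : ∀ c → corner c ~′ old (outer c)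
  corner~outer zero             = inj₂ refl
  corner~outer (suc zero)       = inj₂ refl
  corner~outer (suc (suc zero)) = v~r , (λ _ → refl) , λ r≡v → contradiction r≡v (outer≢v (suc (suc zero)))

  corner~old⇒outer : ∀ c {i} → i ≢ v → corner c ~′ old i → i ≡ outer c
  corner~old⇒outer zero             i≢v (inj₁ i≡v) = contradiction i≡v i≢v
  corner~old⇒outer zero             i≢v (inj₂ eq)  = eq
  corner~old⇒outer (suc zero)       i≢v (inj₁ i≡v) = contradiction i≡v i≢v
  corner~old⇒outer (suc zero)       i≢v (inj₂ eq)  = eq
  corner~old⇒outer (suc (suc zero)) i≢v (_ , ≡r , _) = ≡r refl

  old~old : ∀ {i j} → i ≢ v → j ≢ v → i ~ j → old i ~′ old j
  old~old i≢v j≢v i~j = i~j , (λ i≡v → contradiction i≡v i≢v) , (λ j≡v → contradiction j≡v j≢v)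

  corner≢old : ∀ c {i} → i ≢ v → corner c ≢ old i
  corner≢old (suc (suc zero)) i≢v refl = i≢v refl

  -- Distinct corners are adjacent, and adjacency is irreflexive.
  corner-injective : ∀ c d → corner c ≡ corner d → c ≡ d
  corner-injective c d eq = decidable-stable (c ≟ d) λ c≢d → ~′-irr eq (corner~corner c d c≢d)

  -- A corner sees the two other corners and its outer vertex. An old vertex keeps its neighbours,
  -- except that a neighbour of `v` trades `v` for the corner assigned to it.
  cubic-truncate : Cubic G → Cubic truncate
  cubic-truncate cubic z with view z
  ... | isCorner c = atCorner c
    where
    atCorner : ∀ c → ∃[ a ] ∃[ b ] ∃[ d ] Neighbours truncate (corner c) a b d
    atCorner c = corner d , corner e , old (outer c) , neighbours
        (λ eq → contradiction (punchIn-injective c zero (suc zero) (corner-injective d e eq)) λ ())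
        (corner≢old d (outer≢v c)) (corner≢old e (outer≢v c))
        (corner~corner c d (punchInᵢ≢i c zero ∘ sym))
        (corner~corner c e (punchInᵢ≢i c (suc zero) ∘ sym))
        (corner~outer c) λ {j} → only′ j
      where
      d = punchIn c zero
      e = punchIn c (suc zero)
      others : ∀ f → c ≢ f → f ≡ d ⊎ f ≡ e
      others f c≢f with punchOut c≢f | punchIn-punchOut c≢f
      ... | zero     | eq = inj₁ (sym eq)
      ... | suc zero | eq = inj₂ (sym eq)
      only′ : ∀ j → corner c ~′ j → j ∈ corner d ∷ corner e ∷ old (outer c) ∷ []
      only′ j c~j with view j
      ... | isOld i i≢v = there (there (here (cong old (corner~old⇒outer c i≢v c~j))))
      ... | isCorner f with others f (λ c≡f → ~′-irr (cong corner c≡f) c~j)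
      ...   | inj₁ f≡d = here (cong corner f≡d)
      ...   | inj₂ f≡e = there (here (cong corner f≡e))
  ... | isOld i i≢v with v ~? i
  ...   | no v≁i with cubic i
  ...     | a , b , d , neighbours a≢b a≢d b≢d i~a i~b i~d onlyᵢ =
            old a , old b , old d , neighbours
              (a≢b ∘ old-injective) (a≢d ∘ old-injective) (b≢d ∘ old-injective)
              (lift i~a) (lift i~b) (lift i~d) λ {j} → only′ j
    where
    lift : ∀ {j} → i ~ j → old i ~′ old j
    lift i~j = old~old i≢v (λ { refl → v≁i (~-sym i~j) }) i~j
    only′ : ∀ j → old i ~′ j → j ∈ old a ∷ old b ∷ old d ∷ []
    only′ j i~j with view j
    ... | isOld k _ = ∈-map⁺ old (onlyᵢ (proj₁ i~j))
    ... | isCorner c = contradiction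
            (subst (v ~_) (sym (corner~old⇒outer c i≢v (~′-sym i~j))) (v~outer c)) v≁i
  cubic-truncate cubic z | isOld i i≢v | yes v~i
    with otherTwo G cubic (~-sym v~i) | outer-surjective v~i
  ... | a , b , neighbours v≢a v≢b a≢b _ i~a i~b onlyᵢ | c , i≡c =
          corner c , old a , old b , neighbours
            (corner≢old c (v≢a ∘ sym)) (corner≢old c (v≢b ∘ sym)) (a≢b ∘ old-injective)
            (~′-sym (subst (λ k → corner c ~′ old k) (sym i≡c) (corner~outer c)))
            (old~old i≢v (v≢a ∘ sym) i~a) (old~old i≢v (v≢b ∘ sym) i~b) λ {j} → only′ j
    where
    only′ : ∀ j → old i ~′ j → j ∈ corner c ∷ old a ∷ old b ∷ []
    only′ j i~j with view j
    ... | isCorner d = here (cong corner (outer-injective d c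
            (trans (sym (corner~old⇒outer d i≢v (~′-sym i~j))) i≡c)))
    ... | isOld k k≢v with onlyᵢ (proj₁ i~j)
    ...   | 1st = contradiction refl k≢v
    ...   | 2nd = 2nd
    ...   | 3rd = 3rd

  module _ (conn : ThreeConnected G) where

    -- No corner is deleted, so the triangle stands in for `v`: an edge of `G` at `v` becomes a path
    -- through the corner assigned to its other end.
    connectedOff-old-old : ∀ {a b} → a ≢ v → b ≢ v → ConnectedOff truncate (old a ∷ old b ∷ [])
    connectedOff-old-old {a} {b} a≢v b≢v =
      connectedOff-via G truncate old {a ∷ b ∷ []} (conn a b) lift home
      where
      L = old a ∷ old b ∷ []
      corner∉ : ∀ c → corner c ∉ L
      corner∉ c = ∉-pair (corner≢old c a≢v) (corner≢old c b≢v)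
      old∉ : ∀ {i} → i ∉ a ∷ b ∷ [] → old i ∉ L
      old∉ i∉ = ∉-pair (i∉ ∘ here ∘ old-injective) (i∉ ∘ there ∘ here ∘ old-injective)
      toV : ∀ c → Star (AdjOff truncate L) (corner c) (old v)
      toV c with c ≟ suc (suc zero)
      ... | yes refl = ε
      ... | no c≢2 = return (corner∉ c , corner∉ (suc (suc zero)) , corner~corner c (suc (suc zero)) c≢2)
      fromV : ∀ {j} → v ~ j → j ∉ a ∷ b ∷ [] → Star (AdjOff truncate L) (old v) (old j)
      fromV v~j j∉ with outer-surjective v~j
      ... | c , refl = reverse (AdjOff-sym truncate) (toV c)
                         ◅◅ return (corner∉ c , old∉ j∉ , corner~outer c)
      lift : ∀ {i j} → AdjOff G (a ∷ b ∷ []) i j → Star (AdjOff truncate L) (old i) (old j)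
      lift {i} {j} (i∉ , j∉ , i~j) with i ≟ v | j ≟ v
      ... | yes refl | _ = fromV i~j j∉
      ... | no _ | yes refl = reverse (AdjOff-sym truncate) (fromV (~-sym i~j) i∉)
      ... | no i≢v | no j≢v = return (old∉ i∉ , old∉ j∉ , old~old i≢v j≢v i~j)
      home : ∀ z → z ∉ L → ∃[ i ] (i ∉ a ∷ b ∷ [] × Star (AdjOff truncate L) z (old i))
      home z z∉ with view z
      ... | isOld i _ = i , (λ { 1st → z∉ 1st ; 2nd → z∉ 2nd }) , ε
      ... | isCorner c = v , ∉-pair (a≢v ∘ sym) (b≢v ∘ sym) , toV c

    -- The trace b of the second deleted vertex y is v itself if y is a corner.
    connectedOff-corner : ∀ c {y} b →
      (∀ {i} → i ≢ v → i ≢ b → old i ≢ y) → (∀ {i} → i ≢ v → old i ≢ y → i ≢ b) →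
      (∀ e f → outer e ≡ b → corner f ≢ y) →
      ConnectedOff truncate (corner c ∷ y ∷ [])
    connectedOff-corner c {y} b old≢y ≢b corner≢y =
      connectedOff-via G truncate old {v ∷ b ∷ []} (conn v b) lift home
      where
      L = corner c ∷ y ∷ []
      old∉ : ∀ {i} → i ≢ v → i ≢ b → old i ∉ L
      old∉ i≢v i≢b = ∉-pair (corner≢old c i≢v ∘ sym) (old≢y i≢v i≢b)
      lift : ∀ {i j} → AdjOff G (v ∷ b ∷ []) i j → Star (AdjOff truncate L) (old i) (old j)
      lift (i∉ , j∉ , i~j) = return
        ( old∉ (i∉ ∘ here) (i∉ ∘ there ∘ here) , old∉ (j∉ ∘ here) (j∉ ∘ there ∘ here)
        , old~old (i∉ ∘ here) (j∉ ∘ here) i~j)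
      home : ∀ z → z ∉ L → ∃[ i ] (i ∉ v ∷ b ∷ [] × Star (AdjOff truncate L) z (old i))
      home z z∉ with view z
      ... | isOld i i≢v = i , ∉-pair i≢v (≢b i≢v (z∉ ∘ there ∘ here)) , ε
      ... | isCorner e with outer e ≟ b
      ...   | no e≢b = outer e , ∉-pair (outer≢v e) e≢b ,
                return (z∉ , old∉ (outer≢v e) e≢b , corner~outer e)
      -- The outer vertex of `e` is deleted, so `y` is not a corner. The corner `f` other than `c`
      -- and `e` therefore survives, and so does its outer vertex.
      ...   | yes e≡b with fresh (c ∷ e ∷ []) ℕ.≤-refl
      ...     | f , f∉ = outer f , ∉-pair (outer≢v f) f≢b ,
                  (z∉ , corner-f∉ , corner~corner e f (f∉ ∘ there ∘ here ∘ sym)) ◅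
                  return (corner-f∉ , old∉ (outer≢v f) f≢b , corner~outer f)
        where
        f≢b : outer f ≢ b
        f≢b f≡b = f∉ (there (here (outer-injective f e (trans f≡b (sym e≡b)))))
        corner-f∉ : corner f ∉ L
        corner-f∉ = ∉-pair (f∉ ∘ here ∘ corner-injective f c) (corner≢y e f e≡b)

    connectedOff-corner-old : ∀ c {b} → b ≢ v → ConnectedOff truncate (corner c ∷ old b ∷ [])
    connectedOff-corner-old c {b} b≢v = connectedOff-corner c b
      (λ _ i≢b → i≢b ∘ old-injective) (λ _ i≢b → i≢b ∘ cong old) (λ _ f _ → corner≢old f b≢v)

    threeConnected-truncate : ThreeConnected truncate
    threeConnected-truncate x y with view x | view y
    ... | isOld a a≢v | isOld b b≢v = connectedOff-old-old a≢v b≢v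
    ... | isCorner c  | isOld b b≢v = connectedOff-corner-old c b≢v
    ... | isOld a a≢v | isCorner c  = connectedOff-swap truncate (connectedOff-corner-old c a≢v)
    ... | isCorner c  | isCorner d  = connectedOff-corner c v
            (λ i≢v _ → corner≢old d i≢v ∘ sym) (λ i≢v _ → i≢v)
            (λ e _ e≡v → contradiction e≡v (outer≢v e))

-- Cubic 3-connected graphs of every even order

K₄ : Graph 4
K₄ = record { _~_ = _≢_ ; _~?_ = λ i j → ¬? (i ≟ j) ; ~-sym = _∘ sym ; ~-irr = λ i≡j i≢j → i≢j i≡j }

cubic-K₄ : Cubic K₄
cubic-K₄ v = punchIn v zero , punchIn v (suc zero) , punchIn v (suc (suc zero)) , neighbours
    (distinct λ ()) (distinct λ ()) (distinct λ ()) (adjacent _) (adjacent _) (adjacent _) only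
  where
  distinct : ∀ {i j} → i ≢ j → punchIn v i ≢ punchIn v j
  distinct i≢j = i≢j ∘ punchIn-injective v _ _
  adjacent : ∀ i → v ≢ punchIn v i
  adjacent i = punchInᵢ≢i v i ∘ sym
  only : ∀ {j} → v ≢ j → j ∈ map (punchIn v) (allFin 3)
  only v≢j = subst (_∈ map (punchIn v) (allFin 3)) (punchIn-punchOut v≢j)
    (∈-map⁺ (punchIn v) (∈-allFin (punchOut v≢j)))

threeConnected-K₄ : ThreeConnected K₄
threeConnected-K₄ x y u w u∉ w∉ with u ≟ w
... | yes refl = ε
... | no u≢w   = return (u∉ , w∉ , u≢w)

threeConnectedCubic : ∀ k → ∃[ G ] (Cubic {4 + k * 2} G × ThreeConnected G)
threeConnectedCubic zero    = K₄ , cubic-K₄ , threeConnected-K₄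
threeConnectedCubic (suc k) with threeConnectedCubic k
... | G , cubic , conn with cubic zero
...   | _ , _ , _ , N = truncate , cubic-truncate cubic , threeConnected-truncate conn
  where open Truncate G N

cubic⇒degSum : ∀ {n} (G : Graph n) → Cubic G → degSum G ≡ n * 3
cubic⇒degSum {n} G cubic =
  trans (sum-cong-≗ λ v → neighbours⇒deg≡3 G (proj₂ (proj₂ (proj₂ (cubic v))))) (sum-const n 3)

-- Assembling the extremal graphs by parity of the order

parity : ∀ m → ∃[ k ] (m ≡ k * 2 ⊎ m ≡ 1 + k * 2)
parity zero = 0 , inj₁ refl
parity (suc m) with parity m
... | k , inj₁ m≡2k   = k , inj₂ (cong suc m≡2k)
... | k , inj₂ m≡1+2k = suc k , inj₁ (cong suc m≡1+2k)

-- Used with `3 * n` as `a`: its two forms belong to odd and even `n`, and in both `h` is the floor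
-- of its half.
halve : ∀ {a h s} → 1 + h * 2 ≡ a ⊎ h * 2 ≡ a → s + s ≡ suc h * 2 → s ≡ a / 2 + 1
halve {a} {h} {s} a≡ 2s≡ = begin
  s          ≡⟨ ℕ.*-cancelʳ-≡ s (suc h) 2 (trans (double s) 2s≡) ⟩
  suc h      ≡⟨ ℕ.+-comm 1 h ⟩
  h + 1      ≡⟨ cong (_+ 1) (sym (half a≡)) ⟩
  a / 2 + 1  ∎
  where
  open ≡-Reasoning
  double : ∀ s → s * 2 ≡ s + s
  double s = trans (ℕ.*-comm s 2) (cong (s +_) (+-identityʳ s))
  half : 1 + h * 2 ≡ a ⊎ h * 2 ≡ a → a / 2 ≡ h
  half (inj₂ refl) = m*n/n≡m h 2
  half (inj₁ refl) = trans (+-distrib-/-∣ʳ 1 {d = 2} (divides h refl)) (m*n/n≡m h 2)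

open Attach using (attach; degSum-attach; robust-attach; ¬independentMinimumCut-attach)

attachOne : ∀ {n} → 3 ≤ n → (G : Graph n) → Robust G → ∀ x y → Graph._~_ G x y →
  ∃[ H ] (Connected {1 + n} H × size H + size H ≡ 4 + degSum G × ¬ HasIndependentMinimumVertexCut H)
attachOne 3≤n G robust x y x~y = H ,
    robust⇒connected H (ℕ.m≤n⇒m≤1+n 3≤n) (robust-attach G x y x~y 3≤n robust) ,
    trans (handshake H) (degSum-attach G x y x~y) ,
    ¬independentMinimumCut-attach G x y x~y 3≤n robust
  where H = attach G x y x~y

attachTwo : ∀ {n} → 3 ≤ n → (G : Graph n) → Robust G → ∀ x y → Graph._~_ G x y →
  ∃[ H ] (Connected {2 + n} H × size H + size H ≡ 8 + degSum G × ¬ HasIndependentMinimumVertexCut H)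
attachTwo 3≤n G robust x y x~y =
  let H , connected , 2size≡ , ¬cut =
        attachOne (ℕ.m≤n⇒m≤1+n 3≤n) (attach G x y x~y) (robust-attach G x y x~y 3≤n robust)
          (suc x) (suc y) x~y
  in H , connected , trans 2size≡ (cong (4 +_) (degSum-attach G x y x~y)) , ¬cut

extremalGraph : ∀ n → 7 ≤ n →
  ∃[ G ] (Connected {n} G × size G ≡ (3 * n) / 2 + 1 × ¬ HasIndependentMinimumVertexCut G)
extremalGraph n 7≤n with ℕ.m≤n⇒∃[o]m+o≡n 7≤n
... | m , refl with parity m
-- One new vertex on a cubic graph of order `6 + k * 2` gives `11 + k * 3` edges, one above the
-- floor `10 + k * 3`.
... | k , inj₁ refl =
  let G , cubic , conn = threeConnectedCubic (suc k)
      y , _ , _ , N = cubic zero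
      H , connected , 2size≡ , ¬cut =
        attachOne (s≤s (s≤s (s≤s z≤n))) G (λ x y _ → conn x y) zero y (Neighbours.v~p N)
  in H , connected ,
     halve {h = 10 + k * 3} (inj₁ (odd k)) (trans 2size≡ (trans (cong (4 +_) (cubic⇒degSum G cubic)) (count k))) ,
     ¬cut
  where
  odd : ∀ k → 1 + (10 + k * 3) * 2 ≡ 3 * (7 + k * 2)
  odd = solve-∀
  count : ∀ k → 4 + (6 + k * 2) * 3 ≡ (11 + k * 3) * 2
  count = solve-∀
-- Two new vertices on a cubic graph of order `6 + k * 2` give `13 + k * 3` edges, one above
-- `12 + k * 3`.
... | k , inj₂ refl =
  let G , cubic , conn = threeConnectedCubic (suc k)
      y , _ , _ , N = cubic zero
      H , connected , 2size≡ , ¬cut =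
        attachTwo (s≤s (s≤s (s≤s z≤n))) G (λ x y _ → conn x y) zero y (Neighbours.v~p N)
  in H , connected ,
     halve {h = 12 + k * 3} (inj₂ (even k)) (trans 2size≡ (trans (cong (8 +_) (cubic⇒degSum G cubic)) (count k))) ,
     ¬cut
  where
  even : ∀ k → (12 + k * 3) * 2 ≡ 3 * (7 + (1 + k * 2))
  even = solve-∀
  count : ∀ k → 8 + (6 + k * 2) * 3 ≡ (13 + k * 3) * 2
  count = solve-∀

theorem3 : ((n : ℕ) → 7 ≤ n → (G : Graph n) → Connected G → size G ≤ (3 * n) / 2 →
    HasIndependentMinimumVertexCut G)
    ×
    ((n : ℕ) → 7 ≤ n →
    ∃[ G ] (Connected {n} G × size G ≡ (3 * n) / 2 + 1 × ¬ HasIndependentMinimumVertexCut G))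
theorem3 = fewEdges⇒independentMinimumCut , extremalGraph
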